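{- Let $p,d\geq 1$ be integers and let $a_{ij},b_{ij}\in\mathbb{R}\cup\{ -\infty\}$ for $1\leq i\leq p$, $1\leq j\leq d$. Let $\mathcal{C}\subseteq(\mathbb{R}\cup\{ -\infty\})^d$ be the tropical cone \[ \mathcal{C}=\Big\{x\in(\mathbb{R}\cup\{ -\infty\})^d \;:\; \max_{1\leq j\leq d}(a_{ij}+x_j)\leq \max_{1\leq j\leq d}(b_{ij}+x_j)\ \text{ for all }1\leq i\leq p\Big\}, \] i.e. the intersection of $p$ tropical half-spaces. Then the number of extreme rays of $\mathcal{C}$ is at most $U(p+d,d-1)$.
   Context: The max-plus semiring $\mathbb{R}_{\max}=\mathbb{R}\cup\{ -\infty\}$ has addition $a\oplus b=\max(a,b)$ and multiplication $a\otimes b=a+b$ (with $-\infty$ absorbing for $+$). For vectors, $u\oplus v$ is the entrywise maximum and $\lambda u$ (for $\lambda\in\mathbb{R}_{\max}$) is the vector $(\lambda+u_j)_j$. A tropical cone is a set $\mathcal{C}\subseteq\mathbb{R}_{\max}^d$ such that $u,v\in\mathcal{C}$, $\lambda,\mu\in\mathbb{R}_{\max}$ imply $\lambda u\oplus\mu v\in\mathcal{C}$. A vector $u\in\mathcal{C}$ other than the all-$(-\infty)$ vector is an extreme generator if $u=v\oplus w$ with $v,w\in\mathcal{C}$ implies $u=v$ or $u=w$; the set $\{\lambda u:\lambda\in\mathbb{R}_{\max}\}$ of tropical scalar multiples of an extreme generator $u$ is an extreme ray. For integers $n\geq 0$, $m\geq 0$, with binomial coefficients $\binom{a}{b}=0$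 when $b<0$ or $b>a$, define $U(n,m)=\binom{n-\lfloor m/2\rfloor}{\lfloor m/2\rfloor}+\binom{n-\lfloor m/2\rfloor-1}{\lfloor m/2\rfloor-1}$ if $m$ is even and $U(n,m)=2\binom{n-\lfloor m/2\rfloor-1}{\lfloor m/2\rfloor}$ if $m$ is odd (McMullen's upper bound for the number of facets of a polytope of dimension $m$ with $n$ vertices). -}

module Defs where

open import Level using (0ℓ)
open import Data.Nat as ℕ using (ℕ)
open import Data.Nat.Combinatorics using (_C_)
open import Data.Integer as ℤ using (ℤ; +_; -[1+_])
open import Data.Fin using (Fin; zero; suc)
open import Data.Product using (Σ; ∃; _×_; _,_)
open import Data.Sum using (_⊎_; inj₁; inj₂)
open import Data.Empty using (⊥)
open import Relation.Nullary using (¬_)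
open import Relation.Binary.PropositionalEquality using (_≡_; _≢_)
open import Algebra.Structures using (IsCommutativeRing)
open import Relation.Binary.Structures using (IsTotalOrder)

-- The real numbers, axiomatised as a Dedekind-complete ordered field.
-- (agda-stdlib has no reals; every model of this record is isomorphic
-- to ℝ, so quantifying over all models is the same as stating the
-- result for ℝ.)

record RealField : Set₁ where
  field
    Carrier : Set
    _+_ _*_ : Carrier → Carrier → Carrier
    -_      : Carrier → Carrier
    0r 1r   : Carrier
    _≤_     : Carrier → Carrier → Set
    isCommutativeRing : IsCommutativeRing _≡_ _+_ _*_ -_ 0r 1r
    0≢1     : 0r ≢ 1r
    inverse : ∀ x → x ≢ 0r → ∃ λ y → x * y ≡ 1r
    isTotalOrder : IsTotalOrder _≡_ _≤_
    +-mono  : ∀ x y z → x ≤ y → (x + z) ≤ (y + z)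
    *-pos   : ∀ x y → 0r ≤ x → 0r ≤ y → 0r ≤ (x * y)
    complete : (S : Carrier → Set) → (∃ λ x → S x) →
               (∃ λ b → ∀ x → S x → x ≤ b) →
               ∃ λ s → (∀ x → S x → x ≤ s) ×
                       (∀ b → (∀ x → S x → x ≤ b) → s ≤ b)

module MaxPlus (ℝ : RealField) where
  open RealField ℝ renaming (_+_ to _+ᵣ_; _≤_ to _≤ᵣ_)
  open IsTotalOrder isTotalOrder using (total)

  data ℝmax : Set where
    -∞  : ℝmax
    fin : Carrier → ℝmax

  _⊕_ : ℝmax → ℝmax → ℝmax
  -∞ ⊕ y = y
  fin x ⊕ -∞ = fin x
  fin x ⊕ fin y with total x y
  ... | inj₁ _ = fin y
  ... | inj₂ _ = fin x

  _⊗_ : ℝmax → ℝmax → ℝmax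
  -∞ ⊗ y = -∞
  fin x ⊗ -∞ = -∞
  fin x ⊗ fin y = fin (x +ᵣ y)

  data _≤ₘ_ : ℝmax → ℝmax → Set where
    -∞≤   : ∀ {y} → -∞ ≤ₘ y
    fin≤  : ∀ {x y} → x ≤ᵣ y → fin x ≤ₘ fin y

  maxⱼ : ∀ {d} → (Fin d → ℝmax) → ℝmax
  maxⱼ {ℕ.zero}  f = -∞
  maxⱼ {ℕ.suc d} f = f zero ⊕ maxⱼ (λ j → f (suc j))

  Vecₘ : ℕ → Set
  Vecₘ d = Fin d → ℝmax

  InCone : ∀ {p d} → (A B : Fin p → Fin d → ℝmax) → Vecₘ d → Set
  InCone A B x = ∀ i → maxⱼ (λ j → A i j ⊗ x j) ≤ₘ maxⱼ (λ j → B i j ⊗ x j)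

  Extreme : ∀ {p d} → (A B : Fin p → Fin d → ℝmax) → Vecₘ d → Set
  Extreme A B u =
    InCone A B u ×
    (¬ (∀ j → u j ≡ -∞)) ×
    (∀ v w → InCone A B v → InCone A B w →
       (∀ j → u j ≡ (v j ⊕ w j)) →
       (∀ j → u j ≡ v j) ⊎ (∀ j → u j ≡ w j))

  OnRay : ∀ {d} → Vecₘ d → Vecₘ d → Set
  OnRay u v = ∃ λ (λ' : ℝmax) → ∀ j → v j ≡ (λ' ⊗ u j)

-- Binomial with integer arguments: 0 unless 0 ≤ b ≤ a.

choose : ℤ → ℤ → ℕ
choose (+ a) (+ b) = a C b
choose _ _ = 0

-- McMullen's bound U(n,m)
U : ℕ → ℕ → ℕ
U n m with m ℕ.% 2
... | 0 = choose (+ n ℤ.- + h) (+ h) ℕ.+ choose (+ n ℤ.- + h ℤ.- + 1) (+ h ℤ.- + 1)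
  where h = m ℕ./ 2
... | _ = 2 ℕ.* choose (+ n ℤ.- + h ℤ.- + 1) (+ h)
  where h = m ℕ./ 2

{-# OPTIONS --safe #-}

-- Lift the tropical cone to a classical polyhedral cone over the group ring ℤ[ℝ], ordered by
-- leading coefficients, with the leading exponent as valuation: a point u lifts to t^u, and the
-- valuation maps the lifted cone back into the tropical one.  If u is extreme, moving a lift of u
-- within the lifted cone until it leaves through facets, in a direction and its opposite, writes
-- it as a sum of two points, one of which still lies over u; iterating, some vertex with d − 1
-- independent tight facets lies over u.  So it suffices to bound the number of vertices of a
-- cone with p + d facets, which may well be degenerate.
--
-- Order the vertices by a generic linear functional c/e.  At a vertex, c is a combination of e
-- and the tight facets; let R be the set of those with positive coefficient.  A vertex with a
-- larger value avoids some facet in R, one with a smaller value avoids some tight facet outside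
-- R.  By the skew Bollobás inequality at most (p+1+h choose h) vertices have |R| ≤ h.  For the
-- reversed order the complements of R play the same role, and the remaining vertices are those
-- whose complement has at most d−2−h elements; take h = ⌊(d−1)/2⌋.
module Submission where

open import Defs
open import Level using (0ℓ)
open import Algebra.Bundles using (CommutativeRing)
open import Algebra.Structures using (IsCommutativeRing)
open import Algebra.Solver.Ring.AlmostCommutativeRing using (fromCommutativeRing; _-Raw-AlmostCommutative⟶_)
import Algebra.Properties.AbelianGroup
import Algebra.Properties.Ring
import Algebra.Properties.Semiring.Mult
import Algebra.Properties.Semiring.Sum
import Algebra.Solver.Ring
open import Data.Empty using (⊥; ⊥-elim)
open import Data.Fin using (Fin; zero; suc; toℕ; punchIn; splitAt; join; cast; combine; remQuot)
import Data.Fin.Properties as FinP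
open import Data.Fin.Properties using (any?)
open import Data.Integer as ℤ using (ℤ; +_; -[1+_])
import Data.Integer.Properties as ℤP
open import Data.Integer.Solver using (module +-*-Solver)
import Data.List as List
import Data.List.Properties as ListP
open import Data.List.Membership.Propositional using (_∈_)
open import Data.List.Relation.Unary.Any using (here; there)
import Data.Maybe as Maybe
open import Data.Nat as ℕ using (ℕ; zero; suc; s≤s; z≤n)
open import Data.Nat.Combinatorics using (_C_; nCn≡1; nCk+nC[k+1]≡[n+1]C[k+1])
import Data.Nat.DivMod as DivMod
import Data.Nat.Properties as ℕP
open import Data.Product using (∃; _×_; _,_; proj₁; proj₂)
open import Data.Sum as Sum using (_⊎_; inj₁; inj₂; [_,_]′)
open import Data.Sum.Properties using ([,]-map)
import Data.Vec.Functional as Vector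
open import Data.Vec.Functional.Properties using (insertAt-lookup; insertAt-punchIn)
open import Function using (_∘_)
open import Function.Definitions using (Injective)
open import Relation.Binary.Definitions using (tri<; tri≈; tri>)
import Relation.Binary.PropositionalEquality as ≡
open ≡ using (_≡_; _≢_)
import Relation.Binary.Reasoning.Setoid
open import Relation.Binary.Structures using (IsTotalOrder)
open import Relation.Nullary using (¬_; Dec; yes; no; ¬?)
open import Relation.Nullary.Decidable using (decidable-stable; dec⇒maybe; _×-dec_)

-- What shapes the proof is that neither division nor simplicity is at hand. The group ring is only
-- a domain, but its elements are finite sums: their sign is decidable once equality of reals is,
-- and the leading exponent can be any real. So fractions are cross-multiplied, points matter only
-- up to positive scaling, and kernel vectors come from fraction-free elimination. Integer
-- coefficients help once more: a positive one is at least 1, so doubling absorbs the subtraction of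
-- a monomial of no larger exponent. The classical argument counts vertices of a simple polytope by
-- the sizes of their restriction sets, and would need a perturbation to reach that case. Here each
-- vertex keeps D = d - 1 independent tight facets, out of possibly more, and the other p + 1 facets
-- form the second member of its skew pair. This tolerates degeneracy, since a facet that is loose
-- at another vertex is in particular not among those kept there. The bound for small R and the
-- bound for small complements of R replace the symmetric exact counts of the simple case, and their
-- sum is U.

module IntegerSolver (R : CommutativeRing 0ℓ 0ℓ) where
  open CommutativeRing R
  open Relation.Binary.Reasoning.Setoid setoid
  open Algebra.Properties.Ring ring
    using (-‿distribˡ-*; -‿distribʳ-*; -0#≈0#; -‿involutive)
  open Algebra.Properties.AbelianGroup +-abelianGroup using (⁻¹-∙-comm)
  open Algebra.Properties.Semiring.Mult semiring using (×-homo-+; ×1-homo-*) renaming (_×_ to _×ₙ_)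

  -- Coefficient map for the ring solver. Cancellation in normal forms needs decidable equality of
  -- coefficients, which ℤ has and a general ring need not have.
  fromℤ : ℤ → Carrier
  fromℤ (+ n)    = n ×ₙ 1#
  fromℤ -[1+ n ] = - (suc n ×ₙ 1#)

  fromℤ-neg : ∀ i → fromℤ (ℤ.- i) ≈ - fromℤ i
  fromℤ-neg (+ zero)  = sym -0#≈0#
  fromℤ-neg (+ suc n) = refl
  fromℤ-neg -[1+ n ]  = sym (-‿involutive _)

  fromℤ-⊖ : ∀ m n → fromℤ (m ℤ.⊖ n) ≈ m ×ₙ 1# + - (n ×ₙ 1#)
  fromℤ-⊖ m zero = sym (trans (+-congˡ -0#≈0#) (+-identityʳ _))
  fromℤ-⊖ zero (suc n) = sym (+-identityˡ _)
  fromℤ-⊖ (suc m) (suc n) = begin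
    fromℤ (suc m ℤ.⊖ suc n)              ≡⟨ ≡.cong fromℤ (ℤP.[1+m]⊖[1+n]≡m⊖n m n) ⟩
    fromℤ (m ℤ.⊖ n)                      ≈⟨ fromℤ-⊖ m n ⟩
    a + - b                              ≈⟨ +-congʳ (+-identityˡ a) ⟨
    (0# + a) + - b                       ≈⟨ +-congʳ (+-congʳ (-‿inverseʳ 1#)) ⟨
    ((1# + - 1#) + a) + - b              ≈⟨ +-congʳ (+-assoc _ _ _) ⟩
    (1# + (- 1# + a)) + - b              ≈⟨ +-congʳ (+-congˡ (+-comm _ _)) ⟩
    (1# + (a + - 1#)) + - b              ≈⟨ +-congʳ (+-assoc _ _ _) ⟨
    ((1# + a) + - 1#) + - b              ≈⟨ +-assoc _ _ _ ⟩
    (1# + a) + (- 1# + - b)              ≈⟨ +-congˡ (⁻¹-∙-comm _ _) ⟩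
    (1# + a) + - (1# + b)                ∎
    where
    a = m ×ₙ 1#
    b = n ×ₙ 1#

  fromℤ-+ : ∀ i j → fromℤ (i ℤ.+ j) ≈ fromℤ i + fromℤ j
  fromℤ-+ (+ m)    (+ n)    = ×-homo-+ 1# m n
  fromℤ-+ (+ m)    -[1+ n ] = fromℤ-⊖ m (suc n)
  fromℤ-+ -[1+ m ] (+ n)    = trans (fromℤ-⊖ n (suc m)) (+-comm _ _)
  fromℤ-+ -[1+ m ] -[1+ n ] = begin
    - (suc (suc (m ℕ.+ n)) ×ₙ 1#)      ≡⟨ ≡.cong (λ k → - (suc k ×ₙ 1#)) (ℕP.+-suc m n) ⟨
    - ((suc m ℕ.+ suc n) ×ₙ 1#)        ≈⟨ -‿cong (×-homo-+ 1# (suc m) (suc n)) ⟩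
    - (suc m ×ₙ 1# + suc n ×ₙ 1#)       ≈⟨ ⁻¹-∙-comm _ _ ⟨
    - (suc m ×ₙ 1#) + - (suc n ×ₙ 1#)   ∎

  fromℤ-pos* : ∀ m j → fromℤ (+ m ℤ.* j) ≈ m ×ₙ 1# * fromℤ j
  fromℤ-pos* m (+ n) = trans (reflexive (≡.cong fromℤ (≡.sym (ℤP.pos-* m n)))) (×1-homo-* m n)
  fromℤ-pos* m -[1+ n ] = begin
    fromℤ ((+ m) ℤ.* (ℤ.- + suc n))   ≡⟨ ≡.cong fromℤ (ℤP.neg-distribʳ-* (+ m) (+ suc n)) ⟨
    fromℤ (ℤ.- ((+ m) ℤ.* + suc n))   ≈⟨ fromℤ-neg ((+ m) ℤ.* + suc n) ⟩
    - fromℤ ((+ m) ℤ.* + suc n)       ≈⟨ -‿cong (fromℤ-pos* m (+ suc n)) ⟩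
    - (m ×ₙ 1# * suc n ×ₙ 1#)           ≈⟨ -‿distribʳ-* _ _ ⟩
    m ×ₙ 1# * - (suc n ×ₙ 1#)           ∎

  fromℤ-* : ∀ i j → fromℤ (i ℤ.* j) ≈ fromℤ i * fromℤ j
  fromℤ-* (+ m) j = fromℤ-pos* m j
  fromℤ-* -[1+ m ] j = begin
    fromℤ ((ℤ.- + suc m) ℤ.* j)       ≡⟨ ≡.cong fromℤ (ℤP.neg-distribˡ-* (+ suc m) j) ⟨
    fromℤ (ℤ.- ((+ suc m) ℤ.* j))     ≈⟨ fromℤ-neg ((+ suc m) ℤ.* j) ⟩
    - fromℤ ((+ suc m) ℤ.* j)         ≈⟨ -‿cong (fromℤ-pos* (suc m) j) ⟩
    - (suc m ×ₙ 1# * fromℤ j)          ≈⟨ -‿distribˡ-* _ _ ⟩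
    - (suc m ×ₙ 1#) * fromℤ j          ∎

  private
    morphism : CommutativeRing.rawRing ℤP.+-*-commutativeRing -Raw-AlmostCommutative⟶ fromCommutativeRing R
    morphism = record
      { ⟦_⟧    = fromℤ
      ; +-homo = fromℤ-+
      ; *-homo = fromℤ-*
      ; -‿homo = fromℤ-neg
      ; 0-homo = refl
      ; 1-homo = +-identityʳ 1#
      }

  open Algebra.Solver.Ring (CommutativeRing.rawRing ℤP.+-*-commutativeRing) (fromCommutativeRing R) morphism
    (λ i j → Maybe.map (λ i≡j → reflexive (≡.cong fromℤ i≡j)) (dec⇒maybe (i ℤP.≟ j)))
    public using (solve; _:=_; _:+_; _:*_; _:-_; :-_; con)

-- Linear algebra over a domain

record Domain : Set₁ where
  field
    commutativeRing : CommutativeRing 0ℓ 0ℓ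
  open CommutativeRing commutativeRing
  field
    0≟             : ∀ x → Dec (x ≈ 0#)
    noZeroDivisors : ∀ {x y} → x * y ≈ 0# → x ≈ 0# ⊎ y ≈ 0#
    1≉0            : ¬ (1# ≈ 0#)

module LinearAlgebra (𝔻 : Domain) where
  open Vector using (insertAt)
  open Domain 𝔻 public
  open CommutativeRing commutativeRing public hiding (zero)
  open Relation.Binary.Reasoning.Setoid setoid public
  private module FinSum = Algebra.Properties.Semiring.Sum semiring
  open Algebra.Properties.Ring ring public
    using (-‿distribˡ-*; -‿distribʳ-*; -0#≈0#; -‿involutive)
  open IntegerSolver commutativeRing public using (solve; _:=_; _:+_; _:*_; _:-_; :-_; con)

  -- The library's sum is a fold that reduces on its length; keeping it abstract
  -- lets unification recover the summand.
  abstract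
    sum : ∀ {n} → (Fin n → Carrier) → Carrier
    sum = FinSum.sum

    sum-zero : ∀ {n} {f : Fin n → Carrier} → (∀ i → f i ≈ 0#) → sum f ≈ 0#
    sum-zero {n} f≈0 = trans (FinSum.sum-cong-≋ f≈0) (FinSum.sum-replicate-zero n)

    sum-suc : ∀ {n} (f : Fin (suc n) → Carrier) → sum f ≈ f zero + sum (λ i → f (suc i))
    sum-suc f = refl

    sum-cong : ∀ {n} {f g : Fin n → Carrier} → (∀ i → f i ≈ g i) → sum f ≈ sum g
    sum-cong = FinSum.sum-cong-≋

    sum-remove : ∀ {n} (k : Fin (suc n)) f → sum f ≈ f k + sum (λ i → f (punchIn k i))
    sum-remove k f = FinSum.sum-remove {i = k} f

    sum-+ : ∀ {n} (f g : Fin n → Carrier) → sum (λ i → f i + g i) ≈ sum f + sum g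
    sum-+ = FinSum.∑-distrib-+

    sum-comm : ∀ {m n} (f : Fin m → Fin n → Carrier) →
               sum (λ i → sum (f i)) ≈ sum (λ j → sum (λ i → f i j))
    sum-comm = FinSum.∑-comm

    *-sum : ∀ {n} x (f : Fin n → Carrier) → x * sum f ≈ sum (λ i → x * f i)
    *-sum = FinSum.*-distribˡ-sum

    sum-* : ∀ {n} x (f : Fin n → Carrier) → sum f * x ≈ sum (λ i → f i * x)
    sum-* = FinSum.*-distribʳ-sum

  *-≉0 : ∀ {x y} → ¬ x ≈ 0# → ¬ y ≈ 0# → ¬ x * y ≈ 0#
  *-≉0 x≉0 y≉0 xy≈0 = [ x≉0 , y≉0 ]′ (noZeroDivisors xy≈0)

  sum-single : ∀ {n} (f : Fin n → Carrier) k → (∀ i → ¬ i ≡.≡ k → f i ≈ 0#) → sum f ≈ f k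
  sum-single {suc n} f k f≈0 = begin
    sum f                             ≈⟨ sum-remove k f ⟩
    f k + sum (λ i → f (punchIn k i)) ≈⟨ +-congˡ (sum-zero λ i → f≈0 _ (FinP.punchInᵢ≢i k i)) ⟩
    f k + 0#                          ≈⟨ +-identityʳ _ ⟩
    f k                               ∎

  dot : ∀ {d} → (Fin d → Carrier) → (Fin d → Carrier) → Carrier
  dot a x = sum (λ j → a j * x j)

  dot-lin₁ : ∀ {d} s (a : Fin d → Carrier) t b x →
             dot (λ j → s * a j + t * b j) x ≈ s * dot a x + t * dot b x
  dot-lin₁ s a t b x = begin
    dot (λ j → s * a j + t * b j) x
      ≈⟨ sum-cong (λ j → solve 5 (λ s a t b x → (s :* a :+ t :* b) :* x := s :* (a :* x) :+ t :* (b :* x)) refl s (a j) t (b j) (x j)) ⟩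
    sum (λ j → s * (a j * x j) + t * (b j * x j))
      ≈⟨ sum-+ _ _ ⟩
    sum (λ j → s * (a j * x j)) + sum (λ j → t * (b j * x j))
      ≈⟨ +-cong (*-sum s _) (*-sum t _) ⟨
    s * dot a x + t * dot b x ∎

  dot-comm : ∀ {d} (a x : Fin d → Carrier) → dot a x ≈ dot x a
  dot-comm a x = sum-cong λ j → *-comm _ _

  dot-lin₂ : ∀ {d} a s (x : Fin d → Carrier) t y →
             dot a (λ j → s * x j + t * y j) ≈ s * dot a x + t * dot a y
  dot-lin₂ a s x t y = begin
    dot a (λ j → s * x j + t * y j) ≈⟨ dot-comm a _ ⟩
    dot (λ j → s * x j + t * y j) a ≈⟨ dot-lin₁ s x t y a ⟩
    s * dot x a + t * dot y a       ≈⟨ +-cong (*-congˡ (dot-comm x a)) (*-congˡ (dot-comm y a)) ⟩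
    s * dot a x + t * dot a y       ∎

  dot-scale : ∀ {d} a s (x : Fin d → Carrier) → dot a (λ j → s * x j) ≈ s * dot a x
  dot-scale a s x = begin
    sum (λ j → a j * (s * x j)) ≈⟨ sum-cong (λ j → solve 3 (λ a s x → a :* (s :* x) := s :* (a :* x)) refl (a j) s (x j)) ⟩
    sum (λ j → s * (a j * x j)) ≈⟨ *-sum s _ ⟨
    s * dot a x                 ∎

  dot-combination : ∀ {m d} (γ : Fin m → Carrier) (v : Fin m → Fin d → Carrier) x →
                    sum (λ k → γ k * dot (v k) x) ≈ dot (λ j → sum (λ k → γ k * v k j)) x
  dot-combination γ v x = begin
    sum (λ k → γ k * dot (v k) x)
      ≈⟨ sum-cong (λ k → *-sum (γ k) _) ⟩
    sum (λ k → sum (λ j → γ k * (v k j * x j)))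
      ≈⟨ sum-comm _ ⟩
    sum (λ j → sum (λ k → γ k * (v k j * x j)))
      ≈⟨ sum-cong (λ j → sum-cong λ k → sym (*-assoc (γ k) (v k j) (x j))) ⟩
    sum (λ j → sum (λ k → γ k * v k j * x j))
      ≈⟨ sum-cong (λ j → sum-* (x j) (λ k → γ k * v k j)) ⟨
    dot (λ j → sum (λ k → γ k * v k j)) x ∎

  abstract
    -- Gaussian elimination without division. With pivot `π = v k₀ zero`, the vectors `w k` have
    -- first coordinate 0, so a relation `δ` among their tails is one among the `w k`. Multiplying
    -- out, it becomes a relation among the `v k` with coefficients `π * δ k`, nonzero in a domain,
    -- and `- S` at the pivot vector.
    dependence : ∀ {N m} → N ℕ.< m → (v : Fin m → Fin N → Carrier) →
                 ∃ λ (γ : Fin m → Carrier) →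
                   (∃ λ k → ¬ γ k ≈ 0#) × (∀ i → sum (λ k → γ k * v k i) ≈ 0#)
    dependence {zero} (s≤s _) v = (λ _ → 1#) , (zero , 1≉0) , λ ()
    dependence {suc N} {suc m} (s≤s N<m) v with any? (λ k → ¬? (0≟ (v k zero)))
    ... | no none =
      let γ , γ≉0 , rel = dependence (ℕP.m<n⇒m<1+n N<m) (λ k i → v k (suc i))
      in γ , γ≉0 , λ
        { zero    → sum-zero λ k → trans (*-congˡ (decidable-stable (0≟ _) λ vk≉0 → none (k , vk≉0))) (zeroʳ (γ k))
        ; (suc i) → rel i
        }
    ... | yes (k₀ , π≉0) =
      let δ , (k , δk≉0) , rel = dependence N<m (λ k i → w k (suc i))
          S = sum (λ k → δ k * v (punchIn k₀ k) zero)
          γ = insertAt (λ k → π * δ k) k₀ (- S)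

          rel′ : ∀ i → sum (λ k → δ k * w k i) ≈ 0#
          rel′ = λ
            { zero    → sum-zero λ k →
                solve 3 (λ δ π a → δ :* (π :* a :- a :* π) := con (+ 0)) refl (δ k) π (v (punchIn k₀ k) zero)
            ; (suc i) → rel i
            }
      in γ
       , (punchIn k₀ k , λ γk≈0 →
            *-≉0 π≉0 δk≉0 (trans (reflexive (≡.sym (insertAt-punchIn (λ k → π * δ k) k₀ (- S) k))) γk≈0))
       , λ i → begin
            sum (λ k → γ k * v k i)
              ≈⟨ sum-remove k₀ (λ k → γ k * v k i) ⟩
            γ k₀ * v k₀ i + sum (λ k → γ (punchIn k₀ k) * v (punchIn k₀ k) i)
              ≈⟨ +-cong (*-congʳ (reflexive (insertAt-lookup (λ k → π * δ k) k₀ (- S))))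
                        (sum-cong λ k → *-congʳ (reflexive (insertAt-punchIn (λ k → π * δ k) k₀ (- S) k))) ⟩
            - S * v k₀ i + sum (λ k → π * δ k * v (punchIn k₀ k) i)
              ≈⟨ +-congˡ (sum-cong λ k →
                   solve 5 (λ π δ x a c → π :* δ :* x := δ :* (π :* x :- a :* c) :+ δ :* a :* c) refl
                     π (δ k) (v (punchIn k₀ k) i) (v (punchIn k₀ k) zero) (v k₀ i)) ⟩
            - S * v k₀ i + sum (λ k → δ k * w k i + δ k * v (punchIn k₀ k) zero * v k₀ i)
              ≈⟨ +-congˡ (sum-+ (λ k → δ k * w k i) _) ⟩
            - S * v k₀ i + (sum (λ k → δ k * w k i) + sum (λ k → δ k * v (punchIn k₀ k) zero * v k₀ i))
              ≈⟨ +-congˡ (+-cong (rel′ i) (sym (sum-* (v k₀ i) (λ k → δ k * v (punchIn k₀ k) zero)))) ⟩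
            - S * v k₀ i + (0# + S * v k₀ i)
              ≈⟨ solve 2 (λ S c → (:- S) :* c :+ (con (+ 0) :+ S :* c) := con (+ 0)) refl S (v k₀ i) ⟩
            0# ∎
      where
      π : Carrier
      π = v k₀ zero
      w : Fin m → Fin (suc N) → Carrier
      w k i = π * v (punchIn k₀ k) i - v (punchIn k₀ k) zero * v k₀ i

-- The skew Bollobás inequality

-- All that triangularity asks of an order: the support of a linear relation contains an element
-- below all its other elements.
HasMinima : ∀ {m} → (Fin m → Fin m → Set) → Set₁
HasMinima {m} _≺_ = (S : Fin m → Set) → (∀ k → Dec (S k)) → (∃ λ k → S k) →
                    ∃ λ k → S k × (∀ j → S j → j ≢ k → k ≺ j)

-- The dimension of the space of forms of degree b in v variables.
dim : ℕ → ℕ → ℕ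
dim zero    zero    = 1
dim zero    (suc b) = 0
dim (suc v) zero    = 1
dim (suc v) (suc b) = dim (suc v) b ℕ.+ dim v (suc b)

dim≡C : ∀ a b → dim (suc a) b ≡ (a ℕ.+ b) C a
dim≡C a       zero    = ≡.sym (≡.trans (≡.cong (_C a) (ℕP.+-identityʳ a)) (nCn≡1 a))
dim≡C zero    (suc b) = ≡.cong (ℕ._+ 0) (dim≡C zero b)
dim≡C (suc a) (suc b) = begin
  dim (suc (suc a)) b ℕ.+ dim (suc a) (suc b)         ≡⟨ ≡.cong₂ ℕ._+_ (dim≡C (suc a) b) (dim≡C a (suc b)) ⟩
  (suc a ℕ.+ b) C suc a ℕ.+ (a ℕ.+ suc b) C a         ≡⟨ ≡.cong (λ n → n C suc a ℕ.+ (a ℕ.+ suc b) C a) (ℕP.+-suc a b) ⟨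
  (a ℕ.+ suc b) C suc a ℕ.+ (a ℕ.+ suc b) C a         ≡⟨ ℕP.+-comm ((a ℕ.+ suc b) C suc a) _ ⟩
  (a ℕ.+ suc b) C a ℕ.+ (a ℕ.+ suc b) C suc a         ≡⟨ nCk+nC[k+1]≡[n+1]C[k+1] (a ℕ.+ suc b) a ⟩
  (suc a ℕ.+ suc b) C suc a                           ∎
  where open ≡.≡-Reasoning

module SkewBollobás (𝔻 : Domain) where
  open LinearAlgebra 𝔻
  open Vector using (_++_)

  prod : ∀ {n} → (Fin n → Carrier) → Carrier
  prod {zero}  f = 1#
  prod {suc n} f = f zero * prod (f ∘ suc)

  prod-cong : ∀ {n} {f g : Fin n → Carrier} → (∀ i → f i ≈ g i) → prod f ≈ prod g
  prod-cong {zero}  f≈g = refl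
  prod-cong {suc n} f≈g = *-cong (f≈g zero) (prod-cong (f≈g ∘ suc))

  prod-≉0 : ∀ {n} {f : Fin n → Carrier} → (∀ i → ¬ f i ≈ 0#) → ¬ prod f ≈ 0#
  prod-≉0 {zero}  f≉0 = 1≉0
  prod-≉0 {suc n} f≉0 = *-≉0 (f≉0 zero) (prod-≉0 (f≉0 ∘ suc))

  prod-zero : ∀ {n} {f : Fin n → Carrier} i → f i ≈ 0# → prod f ≈ 0#
  prod-zero zero    fi≈0 = trans (*-congʳ fi≈0) (zeroˡ _)
  prod-zero (suc i) fi≈0 = trans (*-congˡ (prod-zero i fi≈0)) (zeroʳ _)

  -- Homogeneous polynomials in v variables, by the powers of the first variable.
  data Form : ℕ → ℕ → Set where
    const : ∀ {v} → Carrier → Form v zero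
    nil   : ∀ {b} → Form zero (suc b)
    _⊞_   : ∀ {v b} → Form (suc v) b → Form v (suc b) → Form (suc v) (suc b)

  ⟦_⟧ : ∀ {v b} → Form v b → (Fin v → Carrier) → Carrier
  ⟦ const k ⟧ y = k
  ⟦ nil ⟧     y = 0#
  ⟦ F ⊞ G ⟧   y = y zero * ⟦ F ⟧ y + ⟦ G ⟧ (y ∘ suc)

  zeroF : ∀ {v b} → Form v b
  zeroF {b = zero}           = const 0#
  zeroF {zero}  {b = suc b}  = nil
  zeroF {suc v} {b = suc b}  = zeroF ⊞ zeroF

  ⟦zeroF⟧ : ∀ {v b} y → ⟦ zeroF {v} {b} ⟧ y ≈ 0#
  ⟦zeroF⟧ {b = zero}          y = refl
  ⟦zeroF⟧ {zero}  {b = suc b} y = refl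
  ⟦zeroF⟧ {suc v} {b = suc b} y = begin
    y zero * ⟦ zeroF {suc v} {b} ⟧ y + ⟦ zeroF {v} {suc b} ⟧ (y ∘ suc)
      ≈⟨ +-cong (*-congˡ (⟦zeroF⟧ {suc v} {b} y)) (⟦zeroF⟧ {v} {suc b} (y ∘ suc)) ⟩
    y zero * 0# + 0#
      ≈⟨ trans (+-identityʳ _) (zeroʳ _) ⟩
    0# ∎

  axpy : ∀ {v b} → Carrier → Form v b → Form v b → Form v b
  axpy s (const k) (const l) = const (s * k + l)
  axpy s nil       nil       = nil
  axpy s (F ⊞ G)   (F′ ⊞ G′) = axpy s F F′ ⊞ axpy s G G′

  ⟦axpy⟧ : ∀ {v b} s (F G : Form v b) y → ⟦ axpy s F G ⟧ y ≈ s * ⟦ F ⟧ y + ⟦ G ⟧ y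
  ⟦axpy⟧ s (const k) (const l) y = refl
  ⟦axpy⟧ s nil       nil       y = sym (trans (+-identityʳ _) (zeroʳ s))
  ⟦axpy⟧ s (F ⊞ G)   (F′ ⊞ G′) y = trans
    (+-cong (*-congˡ (⟦axpy⟧ s F F′ y)) (⟦axpy⟧ s G G′ (y ∘ suc)))
    (solve 6 (λ x s f g f′ g′ → x :* (s :* f :+ f′) :+ (s :* g :+ g′)
                             := s :* (x :* f :+ g) :+ (x :* f′ :+ g′)) refl
      (y zero) s (⟦ F ⟧ y) (⟦ G ⟧ (y ∘ suc)) (⟦ F′ ⟧ y) (⟦ G′ ⟧ (y ∘ suc)))

  lift : ∀ {v b} → Form v b → Form (suc v) b
  lift {b = zero}  (const k) = const k
  lift {b = suc b} G         = zeroF ⊞ G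

  ⟦lift⟧ : ∀ {v b} (G : Form v b) y → ⟦ lift G ⟧ y ≈ ⟦ G ⟧ (y ∘ suc)
  ⟦lift⟧ {b = zero}      (const k) y = refl
  ⟦lift⟧ {v} {b = suc b} G         y = begin
    y zero * ⟦ zeroF {suc v} {b} ⟧ y + ⟦ G ⟧ (y ∘ suc) ≈⟨ +-congʳ (trans (*-congˡ (⟦zeroF⟧ {suc v} {b} y)) (zeroʳ _)) ⟩
    0# + ⟦ G ⟧ (y ∘ suc)                               ≈⟨ +-identityˡ _ ⟩
    ⟦ G ⟧ (y ∘ suc)                                    ∎

  -- Write a = a₀y₀ + a′ with a′ in the later variables. Then a(y₀F + G) = y₀(aF + a₀G) + a′G, which
  -- is again sorted by powers of y₀.
  linear* : ∀ {v b} → (Fin v → Carrier) → Form v b → Form v (suc b)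
  linear* {zero}  a F         = nil
  linear* {suc v} a (const k) = const (a zero * k) ⊞ linear* (a ∘ suc) (const k)
  linear* {suc v} a (F ⊞ G)   = axpy (a zero) (lift G) (linear* a F) ⊞ linear* (a ∘ suc) G

  ⟦linear*⟧ : ∀ {v b} a (F : Form v b) y → ⟦ linear* a F ⟧ y ≈ dot a y * ⟦ F ⟧ y
  ⟦linear*⟧ {zero}  a F y = sym (trans (*-congʳ (sum-zero λ ())) (zeroˡ _))
  ⟦linear*⟧ {suc v} a (const k) y = begin
    y zero * (a zero * k) + ⟦ linear* (a ∘ suc) (const k) ⟧ (y ∘ suc)
      ≈⟨ +-congˡ (⟦linear*⟧ (a ∘ suc) (const k) (y ∘ suc)) ⟩
    y zero * (a zero * k) + dot (a ∘ suc) (y ∘ suc) * k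
      ≈⟨ solve 4 (λ y a k d → y :* (a :* k) :+ d :* k := (a :* y :+ d) :* k) refl _ _ _ _ ⟩
    (a zero * y zero + dot (a ∘ suc) (y ∘ suc)) * k
      ≈⟨ *-congʳ (sum-suc _) ⟨
    dot a y * k ∎
  ⟦linear*⟧ {suc v} a (F ⊞ G) y = begin
    y₀ * ⟦ axpy (a zero) (lift G) (linear* a F) ⟧ y + ⟦ linear* (a ∘ suc) G ⟧ (y ∘ suc)
      ≈⟨ +-cong (*-congˡ (⟦axpy⟧ (a zero) (lift G) (linear* a F) y)) (⟦linear*⟧ (a ∘ suc) G (y ∘ suc)) ⟩
    y₀ * (a zero * ⟦ lift G ⟧ y + ⟦ linear* a F ⟧ y) + d * g
      ≈⟨ +-congʳ (*-congˡ (+-cong (*-congˡ (⟦lift⟧ G y)) (⟦linear*⟧ a F y))) ⟩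
    y₀ * (a zero * g + dot a y * f) + d * g
      ≈⟨ solve 6 (λ y a g d f D → y :* (a :* g :+ D :* f) :+ d :* g := D :* (y :* f) :+ (a :* y :+ d) :* g) refl
           y₀ (a zero) g d f (dot a y) ⟩
    dot a y * (y₀ * f) + (a zero * y₀ + d) * g
      ≈⟨ +-congˡ (*-congʳ (sum-suc _)) ⟨
    dot a y * (y₀ * f) + dot a y * g
      ≈⟨ distribˡ _ _ _ ⟨
    dot a y * (y₀ * f + g) ∎
    where
    y₀ = y zero
    f  = ⟦ F ⟧ y
    g  = ⟦ G ⟧ (y ∘ suc)
    d  = dot (a ∘ suc) (y ∘ suc)

  linears : ∀ {v b} → (Fin b → Fin v → Carrier) → Form v b
  linears {b = zero}  a = const 1#
  linears {b = suc b} a = linear* (a zero) (linears (a ∘ suc))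

  ⟦linears⟧ : ∀ {v b} (a : Fin b → Fin v → Carrier) y → ⟦ linears a ⟧ y ≈ prod (λ s → dot (a s) y)
  ⟦linears⟧ {b = zero}  a y = refl
  ⟦linears⟧ {b = suc b} a y =
    trans (⟦linear*⟧ (a zero) (linears (a ∘ suc)) y) (*-congˡ (⟦linears⟧ (a ∘ suc) y))

  coefficients : ∀ {v b} → Form v b → Fin (dim v b) → Carrier
  coefficients {zero}  (const k) = λ _ → k
  coefficients {suc v} (const k) = λ _ → k
  coefficients nil               = λ ()
  coefficients (F ⊞ G)           = coefficients F ++ coefficients G

  monomials : ∀ v b → (Fin v → Carrier) → Fin (dim v b) → Carrier
  monomials zero    zero    y = λ _ → 1#
  monomials zero    (suc b) y = λ ()
  monomials (suc v) zero    y = λ _ → 1#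
  monomials (suc v) (suc b) y = (λ i → y zero * monomials (suc v) b y i) ++ monomials v (suc b) (y ∘ suc)

  dot-++ : ∀ {m n} (a a′ : Fin m → Carrier) (b b′ : Fin n → Carrier) →
           dot (a ++ b) (a′ ++ b′) ≈ dot a a′ + dot b b′
  dot-++ {zero}  a a′ b b′ = sym (trans (+-congʳ (sum-zero λ ())) (+-identityˡ _))
  dot-++ {suc m} a a′ b b′ = begin
    dot (a ++ b) (a′ ++ b′)
      ≈⟨ sum-suc _ ⟩
    a zero * a′ zero + sum (λ i → (a ++ b) (suc i) * (a′ ++ b′) (suc i))
      ≈⟨ +-congˡ (sum-cong λ i → *-cong (reflexive ([,]-map (splitAt m i))) (reflexive ([,]-map (splitAt m i)))) ⟩
    a zero * a′ zero + dot ((a ∘ suc) ++ b) ((a′ ∘ suc) ++ b′)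
      ≈⟨ +-congˡ (dot-++ (a ∘ suc) (a′ ∘ suc) b b′) ⟩
    a zero * a′ zero + (dot (a ∘ suc) (a′ ∘ suc) + dot b b′)
      ≈⟨ +-assoc _ _ _ ⟨
    a zero * a′ zero + dot (a ∘ suc) (a′ ∘ suc) + dot b b′
      ≈⟨ +-congʳ (sum-suc _) ⟨
    dot a a′ + dot b b′ ∎

  dot-1 : ∀ k → k ≈ dot {1} (λ _ → k) (λ _ → 1#)
  dot-1 k = sym (trans (sum-suc _) (trans (+-cong (*-identityʳ k) (sum-zero λ ())) (+-identityʳ k)))

  -- Linearises evaluation: a dependence between coefficient vectors becomes a dependence between
  -- the values at every point.
  ⟦⟧-dot : ∀ {v b} (F : Form v b) y → ⟦ F ⟧ y ≈ dot (coefficients F) (monomials v b y)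
  ⟦⟧-dot {zero}  (const k) y = dot-1 k
  ⟦⟧-dot {suc v} (const k) y = dot-1 k
  ⟦⟧-dot nil               y = sym (sum-zero λ ())
  ⟦⟧-dot {suc v} {suc b} (F ⊞ G) y = begin
    y zero * ⟦ F ⟧ y + ⟦ G ⟧ (y ∘ suc)
      ≈⟨ +-cong (*-congˡ (⟦⟧-dot F y)) (⟦⟧-dot G (y ∘ suc)) ⟩
    y zero * dot (coefficients F) (monomials (suc v) b y) + dot (coefficients G) (monomials v (suc b) (y ∘ suc))
      ≈⟨ +-congʳ (dot-scale (coefficients F) (y zero) (monomials (suc v) b y)) ⟨
    dot (coefficients F) (λ i → y zero * monomials (suc v) b y i) + dot (coefficients G) (monomials v (suc b) (y ∘ suc))
      ≈⟨ dot-++ (coefficients F) _ (coefficients G) _ ⟨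
    dot (coefficients (F ⊞ G)) (monomials (suc v) (suc b) y) ∎

  powers : ∀ {n} → Carrier → Fin n → Carrier
  powers s zero    = 1#
  powers s (suc i) = s * powers s i

  -- Padding to length `suc a` puts root sets of different sizes into one space. In (s - t₀)P the
  -- same P occurs twice: `y` stores it one entry shorter, leaving room for the shift that
  -- multiplies by s, and `z` stores it at full length for the multiple by -t₀.
  polynomial-with-roots : ∀ {n a} → n ℕ.≤ a → (t : Fin n → Carrier) →
    ∃ λ (y : Fin (suc a) → Carrier) → ∀ s → dot (powers s) y ≈ prod (λ i → s - t i)
  polynomial-with-roots z≤n t = y , λ s →
    trans (sum-single _ zero λ { zero z≢z → ⊥-elim (z≢z ≡.refl) ; (suc i) _ → zeroʳ _ }) (*-identityˡ 1#)
    where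
    y : ∀ {a} → Fin (suc a) → Carrier
    y zero    = 1#
    y (suc _) = 0#
  polynomial-with-roots {suc n} {suc a} (s≤s n≤a) t
    with polynomial-with-roots n≤a (t ∘ suc) | polynomial-with-roots (ℕP.m≤n⇒m≤1+n n≤a) (t ∘ suc)
  ... | y , y-eq | z , z-eq = (λ i → 1# * shifted i + (- t zero) * z i) , λ s → begin
    dot (powers s) (λ i → 1# * shifted i + (- t zero) * z i)
      ≈⟨ dot-lin₂ (powers s) 1# shifted (- t zero) z ⟩
    1# * dot (powers s) shifted + (- t zero) * dot (powers s) z
      ≈⟨ +-congʳ (*-congˡ (sum-suc _)) ⟩
    1# * (1# * 0# + sum (λ i → s * powers s i * y i)) + (- t zero) * dot (powers s) z
      ≈⟨ +-congʳ (*-congˡ (+-congˡ (trans (sum-cong λ i → *-assoc _ _ _) (sym (*-sum s _))))) ⟩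
    1# * (1# * 0# + s * dot (powers s) y) + (- t zero) * dot (powers s) z
      ≈⟨ +-cong (*-congˡ (+-congˡ (*-congˡ (y-eq s)))) (*-congˡ (z-eq s)) ⟩
    1# * (1# * 0# + s * P s) + (- t zero) * P s
      ≈⟨ +-congʳ (trans (*-identityˡ _) (trans (+-congʳ (zeroʳ _)) (+-identityˡ _))) ⟩
    s * P s + (- t zero) * P s
      ≈⟨ distribʳ _ _ _ ⟨
    (s - t zero) * P s ∎
    where
    P : Carrier → Carrier
    P s = prod (λ i → s - t (suc i))
    shifted : Fin (suc (suc a)) → Carrier
    shifted zero    = 0#
    shifted (suc i) = y i

  difference-≈0 : ∀ {x y} → x ≈ y → x - y ≈ 0#
  difference-≈0 x≈y = trans (+-congʳ x≈y) (-‿inverseʳ _)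

  difference-≉0 : ∀ {x y} → ¬ x ≈ y → ¬ x - y ≈ 0#
  difference-≉0 {x} {y} x≉y x-y≈0 = x≉y (begin
    x           ≈⟨ solve 2 (λ x y → x := (x :- y) :+ y) refl x y ⟩
    (x - y) + y ≈⟨ +-congʳ x-y≈0 ⟩
    0# + y      ≈⟨ +-identityˡ y ⟩
    y           ∎)

  -- The polynomial y ↦ ∏_{s ∈ B j} y(s) is a form of degree b in the a + 1 coefficients
  -- of y; evaluated at ∏_{t ∈ A k} (X − t) these forms are triangular with respect to ≺,
  -- hence independent.
  skew-bound : ∀ {m a b} {_≺_ : Fin m → Fin m → Set} → HasMinima _≺_ →
    (B : Fin m → Fin b → Carrier) (r : Fin m → ℕ) (A : ∀ k → Fin (r k) → Carrier) →
    (∀ k → r k ℕ.≤ a) →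
    (∀ k s t → ¬ B k s ≈ A k t) →
    (∀ k j → k ≺ j → ∃ λ s → ∃ λ t → B j s ≈ A k t) →
    m ℕ.≤ dim (suc a) b
  skew-bound {m} {a} {b} {_≺_} minima B r A r≤a disjoint meet with m ℕP.≤? dim (suc a) b
  ... | yes m≤dim = m≤dim
  ... | no  m≰dim =
    let γ , nonzero , rel = dependence (ℕP.≰⇒> m≰dim) (λ j → coefficients (form j))
        -- At the point `y k` of the least index in the support every other term vanishes by `meet`,
        -- so only the nonzero diagonal term is left of the relation.
        k , γk≉0 , least  = minima (λ k → ¬ γ k ≈ 0#) (λ k → ¬? (0≟ (γ k))) nonzero

        vanishes : ∀ j → j ≢ k → γ j * ⟦ form j ⟧ (y k) ≈ 0#
        vanishes = λ j j≢k → case-zero j j≢k (0≟ (γ j)) (least j)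
    in ⊥-elim (*-≉0 γk≉0 (diagonal k) (begin
         γ k * ⟦ form k ⟧ (y k)
           ≈⟨ sum-single (λ j → γ j * ⟦ form j ⟧ (y k)) k vanishes ⟨
         sum (λ j → γ j * ⟦ form j ⟧ (y k))
           ≈⟨ sum-cong (λ j → *-congˡ (⟦⟧-dot (form j) (y k))) ⟩
         sum (λ j → γ j * dot (coefficients (form j)) (monomials (suc a) b (y k)))
           ≈⟨ dot-combination γ (λ j → coefficients (form j)) (monomials (suc a) b (y k)) ⟩
         dot (λ i → sum (λ j → γ j * coefficients (form j) i)) (monomials (suc a) b (y k))
           ≈⟨ sum-zero (λ i → trans (*-congʳ (rel i)) (zeroˡ _)) ⟩
         0# ∎))
    where
    form : Fin m → Form (suc a) b
    form j = linears (λ s → powers (B j s))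

    y : Fin m → Fin (suc a) → Carrier
    y k = proj₁ (polynomial-with-roots (r≤a k) (A k))

    value : ∀ j k → ⟦ form j ⟧ (y k) ≈ prod (λ s → prod (λ t → B j s - A k t))
    value j k = trans (⟦linears⟧ (λ s → powers (B j s)) (y k))
      (prod-cong λ s → proj₂ (polynomial-with-roots (r≤a k) (A k)) (B j s))

    diagonal : ∀ k → ¬ ⟦ form k ⟧ (y k) ≈ 0#
    diagonal k eq = prod-≉0 (λ s → prod-≉0 λ t → difference-≉0 (disjoint k s t)) (trans (sym (value k k)) eq)

    case-zero : ∀ {γ k} j → j ≢ k → Dec (γ ≈ 0#) → (¬ γ ≈ 0# → j ≢ k → k ≺ j) → γ * ⟦ form j ⟧ (y k) ≈ 0#
    case-zero j j≢k (yes γ≈0) _ = trans (*-congʳ γ≈0) (zeroˡ _)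
    case-zero {k = k} j j≢k (no γ≉0) least with meet k j (least γ≉0 j≢k)
    ... | s , t , eq = trans (*-congˡ (trans (value j k) (prod-zero s (prod-zero t (difference-≈0 eq))))) (zeroʳ _)

-- From restriction sets to the upper bound

HasMinima-∘ : ∀ {m n} {_≺_ : Fin m → Fin m → Set} (f : Fin n → Fin m) → Injective _≡_ _≡_ f →
              HasMinima _≺_ → HasMinima (λ k j → f k ≺ f j)
HasMinima-∘ f f-inj minima S S? (k , Sk)
  with minima (λ x → ∃ λ i → f i ≡ x × S i) (λ x → any? λ i → (f i FinP.≟ x) ×-dec S? i) (f k , k , ≡.refl , Sk)
... | _ , (i , ≡.refl , Si) , least = i , Si , λ j Sj j≢i → least (f j) (j , ≡.refl , Sj) (j≢i ∘ f-inj)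

record Partition {n} (P : Fin n → Set) : Set where
  field
    {#in #out} : ℕ
    total      : #in ℕ.+ #out ≡ n
    ins        : Fin #in → Fin n
    outs       : Fin #out → Fin n
    ins-inj    : Injective _≡_ _≡_ ins
    outs-inj   : Injective _≡_ _≡_ outs
    ins-P      : ∀ i → P (ins i)
    outs-¬P    : ∀ i → ¬ P (outs i)
    ins-all    : ∀ s → P s → ∃ λ i → ins i ≡ s
    outs-all   : ∀ s → ¬ P s → ∃ λ i → outs i ≡ s

cons-zero : ∀ {k n} → (Fin k → Fin n) → Fin (suc k) → Fin (suc n)
cons-zero f zero    = zero
cons-zero f (suc i) = suc (f i)

cons-zero-inj : ∀ {k n} {f : Fin k → Fin n} → Injective _≡_ _≡_ f → Injective _≡_ _≡_ (cons-zero f)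
cons-zero-inj f-inj {zero}  {zero}  eq = ≡.refl
cons-zero-inj f-inj {suc i} {suc j} eq = ≡.cong suc (f-inj (FinP.suc-injective eq))

partition : ∀ {n} (P : Fin n → Set) → (∀ s → Dec (P s)) → Partition P
partition {zero} P P? = record
  { #in = 0 ; #out = 0 ; total = ≡.refl ; ins = λ () ; outs = λ () ; ins-inj = λ { {()} } ; outs-inj = λ { {()} }
  ; ins-P = λ () ; outs-¬P = λ () ; ins-all = λ () ; outs-all = λ () }
partition {suc n} P P? with partition (P ∘ suc) (P? ∘ suc) | P? zero
... | π | yes P₀ = record
  { total    = ≡.cong suc total
  ; ins      = cons-zero ins
  ; outs     = suc ∘ outs
  ; ins-inj  = cons-zero-inj ins-inj
  ; outs-inj = outs-inj ∘ FinP.suc-injective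
  ; ins-P    = λ { zero → P₀ ; (suc i) → ins-P i }
  ; outs-¬P  = outs-¬P
  ; ins-all  = λ { zero _ → zero , ≡.refl
                 ; (suc s) Ps → suc (proj₁ (ins-all s Ps)) , ≡.cong suc (proj₂ (ins-all s Ps)) }
  ; outs-all = λ { zero ¬P₀ → ⊥-elim (¬P₀ P₀)
                 ; (suc s) ¬Ps → proj₁ (outs-all s ¬Ps) , ≡.cong suc (proj₂ (outs-all s ¬Ps)) }
  }
  where open Partition π
... | π | no ¬P₀ = record
  { total    = ≡.trans (ℕP.+-suc _ _) (≡.cong suc total)
  ; ins      = suc ∘ ins
  ; outs     = cons-zero outs
  ; ins-inj  = ins-inj ∘ FinP.suc-injective
  ; outs-inj = cons-zero-inj outs-inj
  ; ins-P    = ins-P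
  ; outs-¬P  = λ { zero → ¬P₀ ; (suc i) → outs-¬P i }
  ; ins-all  = λ { zero P₀ → ⊥-elim (¬P₀ P₀)
                 ; (suc s) Ps → proj₁ (ins-all s Ps) , ≡.cong suc (proj₂ (ins-all s Ps)) }
  ; outs-all = λ { zero _ → zero , ≡.refl
                 ; (suc s) ¬Ps → suc (proj₁ (outs-all s ¬Ps)) , ≡.cong suc (proj₂ (outs-all s ¬Ps)) }
  }
  where open Partition π

-- The domain `Fin b` carries the count: an injective `φ` has exactly D values, which leaves b of
-- the b + D indices. This b will be the degree of the forms.
complement : ∀ {b D} (φ : Fin D → Fin (b ℕ.+ D)) → Injective _≡_ _≡_ φ →
  ∃ λ (f : Fin b → Fin (b ℕ.+ D)) →
    (∀ i t → φ i ≢ f t) × (∀ s → (∀ i → φ i ≢ s) → ∃ λ t → f t ≡ s)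
complement {b} {D} φ φ-inj = ≡.subst
  (λ n → ∃ λ (f : Fin n → Fin (b ℕ.+ D)) → (∀ i t → φ i ≢ f t) × (∀ s → (∀ i → φ i ≢ s) → ∃ λ t → f t ≡ s))
  #out≡b
  (outs , (λ i t eq → outs-¬P t (i , eq)) , (λ s out → outs-all s (λ (i , eq) → out i eq)))
  where
  open Partition (partition (λ s → ∃ λ i → φ i ≡ s) (λ s → any? λ i → φ i FinP.≟ s))
  into : Fin #in → Fin D
  into t = proj₁ (ins-P t)
  into-inj : Injective _≡_ _≡_ into
  into-inj {s} {t} eq = ins-inj (≡.trans (≡.sym (proj₂ (ins-P s))) (≡.trans (≡.cong φ eq) (proj₂ (ins-P t))))
  back : Fin D → Fin #in
  back i = proj₁ (ins-all (φ i) (i , ≡.refl))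
  back-inj : Injective _≡_ _≡_ back
  back-inj {i} {j} eq = φ-inj (≡.trans (≡.sym (proj₂ (ins-all (φ i) (i , ≡.refl))))
    (≡.trans (≡.cong ins eq) (proj₂ (ins-all (φ j) (j , ≡.refl)))))
  #out≡b : #out ≡ b
  #out≡b = ℕP.+-cancelˡ-≡ D #out b (≡.trans
    (≡.cong (ℕ._+ #out) (ℕP.≤-antisym (FinP.injective⇒≤ back-inj) (FinP.injective⇒≤ into-inj)))
    (≡.trans total (ℕP.+-comm b D)))

-- Source of labels for the facets: the skew inequality needs distinct scalars, as many as there are
-- facets.
ℤ-domain : Domain
ℤ-domain = record
  { commutativeRing = ℤP.+-*-commutativeRing
  ; 0≟              = λ i → i ℤP.≟ (+ 0)
  ; noZeroDivisors  = λ {i} → ℤP.i*j≡0⇒i≡0∨j≡0 i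
  ; 1≉0             = λ ()
  }

-- The second set of the pair at `j` is the complement of the image of `φ j`. The pair at `k` is
-- disjoint because `A k` selects within `φ k`, and a facet selected at `k` that is missing from
-- `φ j` lies in the complement at `j`.
skew-bound-facets : ∀ {m a b D} {_≺_ : Fin m → Fin m → Set} → HasMinima _≺_ →
  (φ : Fin m → Fin D → Fin (b ℕ.+ D)) → (∀ k → Injective _≡_ _≡_ (φ k)) →
  (r : Fin m → ℕ) (A : ∀ k → Fin (r k) → Fin D) → (∀ k → r k ℕ.≤ a) →
  (∀ k j → k ≺ j → ∃ λ t → ∀ i → φ j i ≢ φ k (A k t)) →
  m ℕ.≤ (a ℕ.+ b) C a
skew-bound-facets {a = a} {b} minima φ φ-inj r A r≤a exits = ≡.subst (_ ℕ.≤_) (dim≡C a b)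
  (SkewBollobás.skew-bound ℤ-domain minima
    (λ j s → τ (outside j s)) r (λ k t → τ (φ k (A k t))) r≤a
    (λ k s t eq → proj₁ (proj₂ (complement (φ k) (φ-inj k))) (A k t) s (≡.sym (τ-inj eq)))
    (λ k j k≺j → let t , out = exits k j k≺j
                     s , eq  = proj₂ (proj₂ (complement (φ j) (φ-inj j))) _ out
                 in s , t , ≡.cong τ eq))
  where
  outside : ∀ j → Fin b → Fin _
  outside j = proj₁ (complement (φ j) (φ-inj j))
  τ : ∀ {n} → Fin n → ℤ
  τ s = + toℕ s
  τ-inj : ∀ {n} {s t : Fin n} → τ s ≡ τ t → s ≡ t
  τ-inj eq = FinP.toℕ-injective (ℤP.+-injective eq)

-- R k plays the role of the restriction set of the facet set φ k, for the order ≺ and,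
-- complemented in φ k, for the reverse order.
two-sided-bound : ∀ {m b D} {_≺_ : Fin m → Fin m → Set} →
  HasMinima _≺_ → HasMinima (λ k j → j ≺ k) →
  (φ : Fin m → Fin D → Fin (b ℕ.+ D)) → (∀ k → Injective _≡_ _≡_ (φ k)) →
  (R : Fin m → Fin D → Set) → (∀ k i → Dec (R k i)) →
  (∀ k j → k ≺ j → ∃ λ i → R k i × (∀ i′ → φ j i′ ≢ φ k i)) →
  (∀ k j → j ≺ k → ∃ λ i → ¬ R k i × (∀ i′ → φ j i′ ≢ φ k i)) →
  ∀ h → ∃ λ m₁ → ∃ λ m₂ → m₁ ℕ.+ m₂ ≡ m × m₁ ℕ.≤ (h ℕ.+ b) C h ×
    (∀ a → D ℕ.≤ a ℕ.+ suc h → m₂ ℕ.≤ (a ℕ.+ b) C a) × (D ℕ.≤ h → m₂ ≡ 0)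
two-sided-bound {m} {b} {D} {_≺_} minima maxima φ φ-inj R R? below above h =
  #in , #out , total ,
  skew-bound-facets (HasMinima-∘ {_≺_ = _≺_} ins ins-inj minima) (φ ∘ ins) (φ-inj ∘ ins)
    (λ k → Partition.#in (π (ins k))) (λ k → Partition.ins (π (ins k))) ins-P
    (λ k j k≺j → let i , Ri , out = below (ins k) (ins j) k≺j
                     t , eq = Partition.ins-all (π (ins k)) i Ri
                 in t , λ i′ → out i′ ∘ λ e → ≡.trans e (≡.cong (φ (ins k)) eq)) ,
  -- The role of `a` is that of D - 1 - h. The inequality avoids truncated subtraction; the case D ≤
  -- h, where no index is left, is the separate last component.
  (λ a D≤ → skew-bound-facets (HasMinima-∘ {_≺_ = λ k j → j ≺ k} outs outs-inj maxima) (φ ∘ outs) (φ-inj ∘ outs)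
    (λ k → Partition.#out (π (outs k))) (λ k → Partition.outs (π (outs k)))
    (λ k → few-out a D≤ (Partition.total (π (outs k))) (ℕP.≰⇒> (outs-¬P k)))
    (λ k j j≺k → let i , ¬Ri , out = above (outs k) (outs j) j≺k
                     t , eq = Partition.outs-all (π (outs k)) i ¬Ri
                 in t , λ i′ → out i′ ∘ λ e → ≡.trans e (≡.cong (φ (outs k)) eq))) ,
  (λ D≤h → empty (λ k → outs-¬P k (ℕP.≤-trans (ℕP.m+n≤o⇒m≤o _ (ℕP.≤-reflexive (Partition.total (π (outs k))))) D≤h)))
  where
  π : ∀ k → Partition (R k)
  π k = partition (R k) (R? k)
  open Partition (partition (λ k → Partition.#in (π k) ℕ.≤ h) (λ k → Partition.#in (π k) ℕP.≤? h))

  few-out : ∀ a {x y} → D ℕ.≤ a ℕ.+ suc h → x ℕ.+ y ≡ D → h ℕ.< x → y ℕ.≤ a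
  few-out a {x} {y} D≤ x+y≡D h<x = ℕP.+-cancelʳ-≤ (suc h) y a (begin
    y ℕ.+ suc h ≤⟨ ℕP.+-monoʳ-≤ y h<x ⟩
    y ℕ.+ x     ≡⟨ ℕP.+-comm y x ⟩
    x ℕ.+ y     ≡⟨ x+y≡D ⟩
    D           ≤⟨ D≤ ⟩
    a ℕ.+ suc h ∎)
    where open ℕP.≤-Reasoning

  empty : ∀ {n} → (Fin n → ⊥) → n ≡ 0
  empty {zero}  _ = ≡.refl
  empty {suc n} f = ⊥-elim (f zero)

-- McMullen's number at n = p + d, m = d - 1, by parity

+n-+h : ∀ h c → + (h ℕ.+ c) ℤ.- + h ≡ + c
+n-+h h c = ≡.trans (ℤP.m-n≡m⊖n (h ℕ.+ c) h)
  (≡.trans (ℤP.⊖-≥ (ℕP.m≤m+n h c)) (≡.cong +_ (ℕP.m+n∸m≡n h c)))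

U-even : ∀ n m → m ℕ.% 2 ≡ 0 → let h = m ℕ./ 2 in
  U n m ≡ choose (+ n ℤ.- + h) (+ h) ℕ.+ choose (+ n ℤ.- + h ℤ.- + 1) (+ h ℤ.- + 1)
U-even n m eq rewrite eq = ≡.refl

U-odd : ∀ n m → m ℕ.% 2 ≡ 1 → let h = m ℕ./ 2 in
  U n m ≡ 2 ℕ.* choose (+ n ℤ.- + h ℤ.- + 1) (+ h)
U-odd n m eq rewrite eq = ≡.refl

parity : ∀ D → ∃ λ h → (D ≡ h ℕ.* 2) ⊎ (D ≡ suc (h ℕ.* 2))
parity zero = 0 , inj₁ ≡.refl
parity (suc D) with parity D
... | h , inj₁ ≡.refl = h , inj₂ ≡.refl
... | h , inj₂ ≡.refl = suc h , inj₁ ≡.refl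

h*2≡h+h : ∀ h → h ℕ.* 2 ≡ h ℕ.+ h
h*2≡h+h h = ≡.trans (ℕP.*-comm h 2) (≡.cong (h ℕ.+_) (ℕP.+-identityʳ h))

-- The second summand remains a `choose`, because its lower index is -1 when h = 0 and it turns into
-- a binomial coefficient only for positive h.
U-2h : ∀ p h → U (p ℕ.+ suc (h ℕ.* 2)) (h ℕ.* 2) ≡
  (h ℕ.+ suc p) C h ℕ.+ choose (+ (h ℕ.+ p)) (+ h ℤ.- + 1)
U-2h p h = begin
  U n (h ℕ.* 2)
    ≡⟨ U-even n (h ℕ.* 2) (DivMod.m*n%n≡0 h 2) ⟩
  F (h ℕ.* 2 ℕ./ 2)
    ≡⟨ ≡.cong F (DivMod.m*n/n≡m h 2) ⟩
  choose (+ n ℤ.- + h) (+ h) ℕ.+ choose (+ n ℤ.- + h ℤ.- + 1) (+ h ℤ.- + 1)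
    ≡⟨ ≡.cong (λ z → choose z (+ h) ℕ.+ choose (z ℤ.- + 1) (+ h ℤ.- + 1)) n-h ⟩
  (h ℕ.+ suc p) C h ℕ.+ choose (+ (h ℕ.+ suc p) ℤ.- + 1) (+ h ℤ.- + 1)
    ≡⟨ ≡.cong (λ c → (h ℕ.+ suc p) C h ℕ.+ choose (+ c ℤ.- + 1) (+ h ℤ.- + 1)) (ℕP.+-suc h p) ⟩
  (h ℕ.+ suc p) C h ℕ.+ choose (+ suc (h ℕ.+ p) ℤ.- + 1) (+ h ℤ.- + 1)
    ≡⟨ ≡.cong (λ z → (h ℕ.+ suc p) C h ℕ.+ choose z (+ h ℤ.- + 1)) (+n-+h 1 (h ℕ.+ p)) ⟩
  (h ℕ.+ suc p) C h ℕ.+ choose (+ (h ℕ.+ p)) (+ h ℤ.- + 1) ∎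
  where
  open ≡.≡-Reasoning
  n = p ℕ.+ suc (h ℕ.* 2)
  F : ℕ → ℕ
  F h = choose (+ n ℤ.- + h) (+ h) ℕ.+ choose (+ n ℤ.- + h ℤ.- + 1) (+ h ℤ.- + 1)
  n-h : + n ℤ.- + h ≡ + (h ℕ.+ suc p)
  n-h = ≡.trans (≡.cong (λ k → + k ℤ.- + h) (begin
    p ℕ.+ suc (h ℕ.* 2)    ≡⟨ ℕP.+-suc p _ ⟩
    suc p ℕ.+ h ℕ.* 2      ≡⟨ ≡.cong (suc p ℕ.+_) (h*2≡h+h h) ⟩
    suc p ℕ.+ (h ℕ.+ h)    ≡⟨ ℕP.+-comm (suc p) _ ⟩
    h ℕ.+ h ℕ.+ suc p      ≡⟨ ℕP.+-assoc h h (suc p) ⟩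
    h ℕ.+ (h ℕ.+ suc p)    ∎)) (+n-+h h (h ℕ.+ suc p))

U-2h+1 : ∀ p h → U (p ℕ.+ suc (suc (h ℕ.* 2))) (suc (h ℕ.* 2)) ≡ 2 ℕ.* ((h ℕ.+ suc p) C h)
U-2h+1 p h = begin
  U n (suc (h ℕ.* 2))
    ≡⟨ U-odd n (suc (h ℕ.* 2)) (DivMod.[m+kn]%n≡m%n 1 h 2) ⟩
  F (suc (h ℕ.* 2) ℕ./ 2)
    ≡⟨ ≡.cong F (≡.trans (DivMod.+-distrib-/ 1 (h ℕ.* 2) no-carry) (DivMod.m*n/n≡m h 2)) ⟩
  2 ℕ.* choose (+ n ℤ.- + h ℤ.- + 1) (+ h)
    ≡⟨ ≡.cong (λ z → 2 ℕ.* choose (z ℤ.- + 1) (+ h)) n-h ⟩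
  2 ℕ.* choose (+ suc (h ℕ.+ suc p) ℤ.- + 1) (+ h)
    ≡⟨ ≡.cong (λ z → 2 ℕ.* choose z (+ h)) (+n-+h 1 (h ℕ.+ suc p)) ⟩
  2 ℕ.* ((h ℕ.+ suc p) C h) ∎
  where
  open ≡.≡-Reasoning
  n = p ℕ.+ suc (suc (h ℕ.* 2))
  F : ℕ → ℕ
  F h = 2 ℕ.* choose (+ n ℤ.- + h ℤ.- + 1) (+ h)
  no-carry : 1 ℕ.% 2 ℕ.+ (h ℕ.* 2) ℕ.% 2 ℕ.< 2
  no-carry = ≡.subst (λ r → 1 ℕ.+ r ℕ.< 2) (≡.sym (DivMod.m*n%n≡0 h 2)) ℕP.≤-refl
  n-h : + n ℤ.- + h ≡ + suc (h ℕ.+ suc p)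
  n-h = ≡.trans (≡.cong (λ k → + k ℤ.- + h) (begin
    p ℕ.+ suc (suc (h ℕ.* 2))   ≡⟨ ≡.trans (ℕP.+-suc p _) (≡.cong suc (ℕP.+-suc p _)) ⟩
    suc (suc p ℕ.+ h ℕ.* 2)     ≡⟨ ≡.cong (λ k → suc (suc p ℕ.+ k)) (h*2≡h+h h) ⟩
    suc (suc p ℕ.+ (h ℕ.+ h))   ≡⟨ ≡.cong suc (≡.trans (ℕP.+-comm (suc p) _) (ℕP.+-assoc h h (suc p))) ⟩
    suc (h ℕ.+ (h ℕ.+ suc p))   ≡⟨ ℕP.+-suc h _ ⟨
    h ℕ.+ suc (h ℕ.+ suc p)     ∎)) (+n-+h h (suc (h ℕ.+ suc p)))

-- With h = ⌊D/2⌋, the class of large R has complements of size at most D - 1 - h, which is h - 1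
-- for even D and h for odd D. The two binomials are then the two summands of `U`, equal ones in the
-- odd case.
upper-bound : ∀ {m D} p {_≺_ : Fin m → Fin m → Set} →
  HasMinima _≺_ → HasMinima (λ k j → j ≺ k) →
  (φ : Fin m → Fin D → Fin (suc p ℕ.+ D)) → (∀ k → Injective _≡_ _≡_ (φ k)) →
  (R : Fin m → Fin D → Set) → (∀ k i → Dec (R k i)) →
  (∀ k j → k ≺ j → ∃ λ i → R k i × (∀ i′ → φ j i′ ≢ φ k i)) →
  (∀ k j → j ≺ k → ∃ λ i → ¬ R k i × (∀ i′ → φ j i′ ≢ φ k i)) →
  m ℕ.≤ U (p ℕ.+ suc D) D
upper-bound {D = D} p {_≺_} minima maxima φ φ-inj R R? below above
  with parity D
... | h , parity-D with two-sided-bound {_≺_ = _≺_} minima maxima φ φ-inj R R? below above h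
-- For D = 0 the second class is empty, in agreement with the lower index -1 in `U`.
upper-bound p minima maxima φ φ-inj R R? below above
  | zero , inj₁ ≡.refl | m₁ , m₂ , ≡.refl , m₁≤ , m₂≤ , m₂≡0 = ≡.subst (m₁ ℕ.+ m₂ ℕ.≤_) (≡.sym (U-2h p 0))
      (ℕP.+-mono-≤ m₁≤ (ℕP.≤-reflexive (m₂≡0 z≤n)))
upper-bound p minima maxima φ φ-inj R R? below above
  | suc h , inj₁ ≡.refl | m₁ , m₂ , ≡.refl , m₁≤ , m₂≤ , _ = ≡.subst (m₁ ℕ.+ m₂ ℕ.≤_) (≡.sym (U-2h p (suc h)))
      (ℕP.+-mono-≤ m₁≤ (≡.subst (λ c → m₂ ℕ.≤ c C h) (ℕP.+-suc h p) (m₂≤ h (ℕP.≤-reflexive D≡))))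
  where
  D≡ : suc h ℕ.* 2 ≡ h ℕ.+ suc (suc h)
  D≡ = ≡.trans (h*2≡h+h (suc h)) (≡.sym (ℕP.+-suc h (suc h)))
upper-bound p minima maxima φ φ-inj R R? below above
  | h , inj₂ ≡.refl | m₁ , m₂ , ≡.refl , m₁≤ , m₂≤ , _ = ≡.subst (m₁ ℕ.+ m₂ ℕ.≤_) (≡.sym (U-2h+1 p h))
      (ℕP.+-mono-≤ m₁≤ (≡.subst (m₂ ℕ.≤_) (≡.sym (ℕP.+-identityʳ _)) (m₂≤ h (ℕP.≤-reflexive D≡))))
  where
  D≡ : suc (h ℕ.* 2) ≡ h ℕ.+ suc h
  D≡ = ≡.trans (≡.cong suc (h*2≡h+h h)) (≡.sym (ℕP.+-suc h h))

-- Ordered domains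

record OrderedDomain : Set₁ where
  field
    commutativeRing : CommutativeRing 0ℓ 0ℓ
  open CommutativeRing commutativeRing
  field
    Pos        : Carrier → Set
    Pos-resp   : ∀ {x y} → x ≈ y → Pos x → Pos y
    trichotomy : ∀ x → Pos x ⊎ x ≈ 0# ⊎ Pos (- x)
    Pos⇒≉0     : ∀ {x} → Pos x → ¬ x ≈ 0#
    Pos-+      : ∀ {x y} → Pos x → Pos y → Pos (x + y)
    Pos-*      : ∀ {x y} → Pos x → Pos y → Pos (x * y)
    Pos-1      : Pos 1#
    -- Substitute for division in a ring that may be neither a field nor archimedean: it yields
    -- multipliers M so large that M a + b is positive.
    cofinal    : ∀ {a} → Pos a → ∃ λ m → Pos m × Pos (m * a - 1#)

module OrderedDomainProperties (𝕆 : OrderedDomain) where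
  open OrderedDomain 𝕆 using (Pos; Pos-resp; trichotomy; Pos⇒≉0; Pos-+; Pos-*; Pos-1; cofinal) public

  domain : Domain
  domain = record
    { commutativeRing = commutativeRing
    ; 0≟              = λ x → dec (trichotomy x)
    ; noZeroDivisors  = λ {x} {y} → cases (trichotomy x) (trichotomy y)
    ; 1≉0             = Pos⇒≉0 Pos-1
    }
    where
    open OrderedDomain 𝕆 using (commutativeRing)
    open CommutativeRing commutativeRing hiding (zero)
    open IntegerSolver commutativeRing

    neg≈0 : ∀ {x} → x ≈ 0# → - x ≈ 0#
    neg≈0 x≈0 = trans (-‿cong x≈0) (Algebra.Properties.Ring.-0#≈0# ring)

    dec : ∀ {x} → Pos x ⊎ x ≈ 0# ⊎ Pos (- x) → Dec (x ≈ 0#)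
    dec (inj₁ x>0)        = no (Pos⇒≉0 x>0)
    dec (inj₂ (inj₁ x≈0)) = yes x≈0
    dec (inj₂ (inj₂ x<0)) = no λ x≈0 → Pos⇒≉0 x<0 (neg≈0 x≈0)

    cases : ∀ {x y} → Pos x ⊎ x ≈ 0# ⊎ Pos (- x) → Pos y ⊎ y ≈ 0# ⊎ Pos (- y) →
            x * y ≈ 0# → x ≈ 0# ⊎ y ≈ 0#
    cases (inj₂ (inj₁ x≈0)) _ _ = inj₁ x≈0
    cases _ (inj₂ (inj₁ y≈0)) _ = inj₂ y≈0
    cases (inj₁ x>0) (inj₁ y>0) xy≈0 = ⊥-elim (Pos⇒≉0 (Pos-* x>0 y>0) xy≈0)
    cases {x} {y} (inj₁ x>0) (inj₂ (inj₂ y<0)) xy≈0 = ⊥-elim (Pos⇒≉0 (Pos-* x>0 y<0)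
      (trans (solve 2 (λ x y → x :* (:- y) := :- (x :* y)) refl x y) (neg≈0 xy≈0)))
    cases {x} {y} (inj₂ (inj₂ x<0)) (inj₁ y>0) xy≈0 = ⊥-elim (Pos⇒≉0 (Pos-* x<0 y>0)
      (trans (solve 2 (λ x y → (:- x) :* y := :- (x :* y)) refl x y) (neg≈0 xy≈0)))
    cases {x} {y} (inj₂ (inj₂ x<0)) (inj₂ (inj₂ y<0)) xy≈0 = ⊥-elim (Pos⇒≉0 (Pos-* x<0 y<0)
      (trans (solve 2 (λ x y → (:- x) :* (:- y) := x :* y) refl x y) xy≈0))

  open LinearAlgebra domain public hiding (_≉_)

  NonNeg : Carrier → Set
  NonNeg x = Pos x ⊎ x ≈ 0#

  NonNeg-resp : ∀ {x y} → x ≈ y → NonNeg x → NonNeg y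
  NonNeg-resp x≈y (inj₁ x>0) = inj₁ (Pos-resp x≈y x>0)
  NonNeg-resp x≈y (inj₂ x≈0) = inj₂ (trans (sym x≈y) x≈0)

  Pos-NonNeg-+ : ∀ {x y} → Pos x → NonNeg y → Pos (x + y)
  Pos-NonNeg-+ x>0 (inj₁ y>0) = Pos-+ x>0 y>0
  Pos-NonNeg-+ x>0 (inj₂ y≈0) = Pos-resp (sym (trans (+-congˡ y≈0) (+-identityʳ _))) x>0

  NonNeg-+ : ∀ {x y} → NonNeg x → NonNeg y → NonNeg (x + y)
  NonNeg-+ (inj₁ x>0) y≥0 = inj₁ (Pos-NonNeg-+ x>0 y≥0)
  NonNeg-+ (inj₂ x≈0) y≥0 = NonNeg-resp (sym (trans (+-congʳ x≈0) (+-identityˡ _))) y≥0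

  NonNeg-* : ∀ {x y} → NonNeg x → NonNeg y → NonNeg (x * y)
  NonNeg-* (inj₁ x>0) (inj₁ y>0) = inj₁ (Pos-* x>0 y>0)
  NonNeg-* (inj₂ x≈0) _          = inj₂ (trans (*-congʳ x≈0) (zeroˡ _))
  NonNeg-* (inj₁ _)   (inj₂ y≈0) = inj₂ (trans (*-congˡ y≈0) (zeroʳ _))

  NonNeg-sum : ∀ {n} {f : Fin n → Carrier} → (∀ i → NonNeg (f i)) → NonNeg (sum f)
  NonNeg-sum {zero}  f≥0 = inj₂ (sum-zero λ ())
  NonNeg-sum {suc n} f≥0 = NonNeg-resp (sym (sum-suc _)) (NonNeg-+ (f≥0 zero) (NonNeg-sum (f≥0 ∘ suc)))

  Pos-asym : ∀ {x} → Pos x → ¬ Pos (- x)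
  Pos-asym x>0 x<0 = Pos⇒≉0 (Pos-+ x>0 x<0) (-‿inverseʳ _)

  Pos-neg⇒¬NonNeg : ∀ {x} → Pos (- x) → ¬ NonNeg x
  Pos-neg⇒¬NonNeg x<0 x≥0 = Pos⇒≉0 (Pos-NonNeg-+ x<0 x≥0) (-‿inverseˡ _)

  nonNeg? : ∀ x → NonNeg x ⊎ Pos (- x)
  nonNeg? x with trichotomy x
  ... | inj₁ x>0        = inj₁ (inj₁ x>0)
  ... | inj₂ (inj₁ x≈0) = inj₁ (inj₂ x≈0)
  ... | inj₂ (inj₂ x<0) = inj₂ x<0

  ¬Pos⇒NonNeg-neg : ∀ {x} → ¬ Pos x → NonNeg (- x)
  ¬Pos⇒NonNeg-neg {x} x≯0 with trichotomy x
  ... | inj₁ x>0        = ⊥-elim (x≯0 x>0)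
  ... | inj₂ (inj₁ x≈0) = inj₂ (trans (-‿cong x≈0) -0#≈0#)
  ... | inj₂ (inj₂ x<0) = inj₁ x<0

  pos? : ∀ x → Dec (Pos x)
  pos? x with trichotomy x
  ... | inj₁ x>0        = yes x>0
  ... | inj₂ (inj₁ x≈0) = no λ x>0 → Pos⇒≉0 x>0 x≈0
  ... | inj₂ (inj₂ x<0) = no λ x>0 → Pos-asym x>0 x<0

  NonNeg-cancelˡ : ∀ {q z} → Pos q → NonNeg (q * z) → NonNeg z
  NonNeg-cancelˡ {q} {z} q>0 qz≥0 with nonNeg? z
  ... | inj₁ z≥0 = z≥0
  ... | inj₂ z<0 = ⊥-elim (Pos-neg⇒¬NonNeg (Pos-resp (sym (-‿distribʳ-* q z)) (Pos-* q>0 z<0)) qz≥0)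

  Pos-square : ∀ {x} → ¬ x ≈ 0# → Pos (x * x)
  Pos-square {x} x≉0 with trichotomy x
  ... | inj₁ x>0        = Pos-* x>0 x>0
  ... | inj₂ (inj₁ x≈0) = ⊥-elim (x≉0 x≈0)
  ... | inj₂ (inj₂ x<0) = Pos-resp (solve 1 (λ x → (:- x) :* (:- x) := x :* x) refl x) (Pos-* x<0 x<0)

  -- The fractions `p k / q k` are compared by cross-multiplication, which is legitimate as `q` is
  -- positive on `S`.
  argmin : ∀ {n} (p q : Fin n → Carrier) (S : Fin n → Set) → (∀ k → Dec (S k)) →
           (∀ k → S k → Pos (q k)) → (∃ λ k → S k) →
           ∃ λ g → S g × (∀ f → S f → NonNeg (p f * q g - p g * q f))
  argmin {suc n} p q S S? q>0 nonempty with any? (S? ∘ suc)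
  ... | no none = zero , S₀ nonempty , λ
        { zero    _  → inj₂ (-‿inverseʳ _)
        ; (suc f) Sf → ⊥-elim (none (f , Sf))
        }
        where
        S₀ : (∃ λ k → S k) → S zero
        S₀ (zero  , S₀) = S₀
        S₀ (suc k , Sk) = ⊥-elim (none (k , Sk))
  ... | yes some with argmin (p ∘ suc) (q ∘ suc) (S ∘ suc) (S? ∘ suc) (q>0 ∘ suc) some | S? zero
  ...   | g , Sg , least | no ¬S₀ = suc g , Sg , λ
          { zero    S₀ → ⊥-elim (¬S₀ S₀)
          ; (suc f) Sf → least f Sf
          }
  ...   | g , Sg , least | yes S₀ with nonNeg? (p zero * q (suc g) - p (suc g) * q zero)
  ...     | inj₁ g≤0 = suc g , Sg , λ { zero _ → g≤0 ; (suc f) Sf → least f Sf }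
  ...     | inj₂ 0<g = zero , S₀ , λ
            { zero    _  → inj₂ (-‿inverseʳ _)
            -- Transitivity of the order of fractions: the two known differences combine to
            -- `q (suc g)` times the desired one, and this positive factor cancels.
            ; (suc f) Sf → NonNeg-cancelˡ (q>0 (suc g) Sg) (NonNeg-resp
                (solve 6 (λ p₀ q₀ pg qg pf qf →
                   q₀ :* (pf :* qg :- pg :* qf) :+ qf :* (:- (p₀ :* qg :- pg :* q₀))
                   := qg :* (pf :* q₀ :- p₀ :* qf)) refl
                   (p zero) (q zero) (p (suc g)) (q (suc g)) (p (suc f)) (q (suc f)))
                (NonNeg-+ (NonNeg-* (inj₁ (q>0 zero S₀)) (least f Sf))
                          (inj₁ (Pos-* (q>0 (suc f) Sf) 0<g))))
            }

  ratio-minima : ∀ {m} (p q : Fin m → Carrier) → (∀ k → Pos (q k)) →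
                 (∀ j k → j ≢ k → ¬ p j * q k - p k * q j ≈ 0#) →
                 HasMinima (λ k j → Pos (p j * q k - p k * q j))
  ratio-minima p q q>0 distinct S S? nonempty with argmin p q S S? (λ k _ → q>0 k) nonempty
  ... | g , Sg , least = g , Sg , λ j Sj j≢g →
        [ (λ lt → lt) , (λ eq → ⊥-elim (distinct j g j≢g eq)) ]′ (least j Sj)

  eventually-Pos : ∀ {a} b → Pos a → ∃ λ M₀ → Pos M₀ × (∀ M → NonNeg (M - M₀) → Pos (M * a + b))
  eventually-Pos {a} b a>0 with cofinal a>0 | bound (trichotomy b)
    where
    bound : Pos b ⊎ b ≈ 0# ⊎ Pos (- b) → ∃ λ β → Pos β × Pos (β + b)
    bound (inj₁ b>0)        = 1# , Pos-1 , Pos-+ Pos-1 b>0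
    bound (inj₂ (inj₁ b≈0)) = 1# , Pos-1 , Pos-resp (sym (trans (+-congˡ b≈0) (+-identityʳ 1#))) Pos-1
    bound (inj₂ (inj₂ b<0)) = 1# - b , Pos-+ Pos-1 b<0 ,
      Pos-resp (solve 2 (λ o b → o := o :- b :+ b) refl 1# b) Pos-1
  -- With threshold mβ, M a + b = β(m a - 1) + (β + b) + (M - mβ)a, where the first two terms are
  -- positive and the third is nonnegative.
  ... | m , m>0 , ma>1 | β , β>0 , β+b>0 = m * β , Pos-* m>0 β>0 , λ M M≥ → Pos-resp
        (solve 5 (λ M a b m β → β :* (m :* a :- con (+ 1)) :+ (β :+ b) :+ (M :- m :* β) :* a := M :* a :+ b) refl M a b m β)
        (Pos-NonNeg-+ (Pos-+ (Pos-* β>0 (Pos-resp (+-congˡ (-‿cong (sym (+-identityʳ 1#)))) ma>1)) β+b>0)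
                      (NonNeg-* M≥ (inj₁ a>0)))

  eventually-≉0 : ∀ {a} b → ¬ a ≈ 0# → ∃ λ M₀ → Pos M₀ × (∀ M → NonNeg (M - M₀) → ¬ M * a + b ≈ 0#)
  eventually-≉0 {a} b a≉0 with trichotomy a
  ... | inj₂ (inj₁ a≈0) = ⊥-elim (a≉0 a≈0)
  ... | inj₁ a>0 with eventually-Pos b a>0
  ...   | M₀ , M₀>0 , large = M₀ , M₀>0 , λ M M≥ → Pos⇒≉0 (large M M≥)
  eventually-≉0 {a} b a≉0 | inj₂ (inj₂ a<0) with eventually-Pos (- b) a<0
  ...   | M₀ , M₀>0 , large = M₀ , M₀>0 , λ M M≥ eq → Pos⇒≉0 (large M M≥)
          (trans (solve 3 (λ M a b → M :* (:- a) :+ (:- b) := :- (M :* a :+ b)) refl M a b) (trans (-‿cong eq) -0#≈0#))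

  eventually-all-≉0 : ∀ {n} (a b : Fin n → Carrier) →
    ∃ λ M₀ → Pos M₀ × (∀ M → NonNeg (M - M₀) → ∀ i → ¬ a i ≈ 0# → ¬ M * a i + b i ≈ 0#)
  eventually-all-≉0 {zero}  a b = 1# , Pos-1 , λ _ _ ()
  eventually-all-≉0 {suc n} a b with eventually-all-≉0 (a ∘ suc) (b ∘ suc) | 0≟ (a zero)
  ... | M₀ , M₀>0 , tail | yes a≈0 = M₀ , M₀>0 , λ
        { M M≥ zero    a≉0 → ⊥-elim (a≉0 a≈0)
        ; M M≥ (suc i)     → tail M M≥ i
        }
  ... | M₀ , M₀>0 , tail | no a≉0 with eventually-≉0 (b zero) a≉0
  ...   | M₁ , M₁>0 , head = M₀ + M₁ , Pos-+ M₀>0 M₁>0 , λ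
          { M M≥ zero    _ → head M (NonNeg-resp
              (solve 3 (λ M x y → (M :- (x :+ y)) :+ x := M :- y) refl M M₀ M₁) (NonNeg-+ M≥ (inj₁ M₀>0)))
          ; M M≥ (suc i)   → tail M (NonNeg-resp
              (solve 3 (λ M x y → (M :- (x :+ y)) :+ y := M :- x) refl M M₀ M₁) (NonNeg-+ M≥ (inj₁ M₁>0))) i
          }

  δ : ∀ {d} → Fin d → Fin d → Carrier
  δ j i with i FinP.≟ j
  ... | yes _ = 1#
  ... | no  _ = 0#

  δ-diag : ∀ {d} (j : Fin d) → δ j j ≈ 1#
  δ-diag j with j FinP.≟ j
  ... | yes _  = refl
  ... | no j≢j = ⊥-elim (j≢j ≡.refl)

  δ-off : ∀ {d} {i j : Fin d} → i ≢ j → δ j i ≈ 0#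
  δ-off {i = i} {j} i≢j with i FinP.≟ j
  ... | yes i≡j = ⊥-elim (i≢j i≡j)
  ... | no  _   = refl

  dot-δ : ∀ {d} j (x : Fin d → Carrier) → dot (δ j) x ≈ x j
  dot-δ j x = begin
    dot (δ j) x ≈⟨ sum-single _ j (λ i i≢j → trans (*-congʳ (δ-off i≢j)) (zeroˡ _)) ⟩
    δ j j * x j ≈⟨ *-congʳ (δ-diag j) ⟩
    1# * x j    ≈⟨ *-identityˡ _ ⟩
    x j         ∎

  abstract
    -- If `c` vanishes on the new vector, take M c + `δ j` for a nonzero coordinate j of that
    -- vector. Its value there is this coordinate, and for large M the nonzero values on the earlier
    -- vectors do not become 0.
    generic-functional : ∀ {n d} (W : Fin n → Fin d → Carrier) →
      ∃ λ c → ∀ i → (∃ λ j → ¬ W i j ≈ 0#) → ¬ dot c (W i) ≈ 0#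
    generic-functional {zero}  W = (λ _ → 0#) , λ ()
    generic-functional {suc n} {d} W with generic-functional (W ∘ suc) | any? (λ j → ¬? (0≟ (W zero j)))
    ... | c , c≉0 | no none = c , λ { zero some → ⊥-elim (none some) ; (suc i) → c≉0 i }
    ... | c , c≉0 | yes (j , W₀ⱼ≉0) with 0≟ (dot c (W zero))
    ...   | no  c₀≉0 = c , λ { zero _ → c₀≉0 ; (suc i) → c≉0 i }
    ...   | yes c₀≈0 with eventually-all-≉0 (λ i → dot c (W (suc i))) (λ i → W (suc i) j)
    ...     | M , _ , large = c′ , λ
              { zero    _    eq → W₀ⱼ≉0 (trans (sym (trans (+-congʳ (trans (*-congˡ c₀≈0) (zeroʳ M))) (+-identityˡ _)))
                                               (trans (sym (value zero)) eq))
              ; (suc i) some eq → large M (inj₂ (-‿inverseʳ M)) i (c≉0 i some) (trans (sym (value (suc i))) eq)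
              }
              where
              c′ : Fin d → Carrier
              c′ k = M * c k + 1# * δ j k
              value : ∀ i → dot c′ (W i) ≈ M * dot c (W i) + W i j
              value i = trans (dot-lin₁ M c 1# (δ j) (W i)) (+-congˡ (trans (*-identityˡ _) (dot-δ j (W i))))

-- Vertices of polyhedral cones

module PolyhedralCone (𝕆 : OrderedDomain) where
  open OrderedDomainProperties 𝕆

  -- The cone of all x with M f · x ≥ 0 for every f; `pointed` says that e is positive on it.
  module Cone {N D : ℕ} (M : Fin N → Fin (suc D) → Carrier) (e : Fin (suc D) → Carrier)
    (pointed : ∀ w → (∃ λ j → ¬ w j ≈ 0#) → dot e w ≈ 0# → ∃ λ f → Pos (- dot (M f) w)) where

    open Vector using (_∷_)

    Vec : Set
    Vec = Fin (suc D) → Carrier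

    ℓ : Fin N → Vec → Carrier
    ℓ f x = dot (M f) x

    InK : Vec → Set
    InK x = ∀ f → NonNeg (ℓ f x)

    Independent : ∀ {r} → (Fin r → Fin N) → Set
    Independent {r} φ = ∀ (h : Fin r → Carrier) → (∀ y → sum (λ i → h i * ℓ (φ i) y) ≈ 0#) → ∀ i → h i ≈ 0#

    record Frame (r : ℕ) (x : Vec) : Set where
      field
        φ           : Fin r → Fin N
        tight       : ∀ i → ℓ (φ i) x ≈ 0#
        independent : Independent φ

    -- A repetition `φ i ≡ φ j` would make `δ i` minus `δ j` a relation, with coefficient 1 at i.
    independent⇒injective : ∀ {r} {φ : Fin r → Fin N} → Independent φ → Injective _≡_ _≡_ φ
    independent⇒injective {r} {φ} independent {i} {j} φi≡φj with i FinP.≟ j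
    ... | yes i≡j = i≡j
    ... | no  i≢j = ⊥-elim (1≉0 (begin
      1#                          ≈⟨ trans (+-cong (*-identityˡ 1#) (zeroʳ _)) (+-identityʳ _) ⟨
      1# * 1# + - 1# * 0#         ≈⟨ +-cong (*-congˡ (δ-diag i)) (*-congˡ (δ-off i≢j)) ⟨
      h i                         ≈⟨ independent h vanishes i ⟩
      0#                          ∎))
      where
      h : Fin r → Carrier
      h k = 1# * δ i k + (- 1#) * δ j k
      vanishes : ∀ y → dot h (λ k → ℓ (φ k) y) ≈ 0#
      vanishes y = begin
        dot h (λ k → ℓ (φ k) y)
          ≈⟨ dot-lin₁ 1# (δ i) (- 1#) (δ j) _ ⟩
        1# * dot (δ i) (λ k → ℓ (φ k) y) + - 1# * dot (δ j) (λ k → ℓ (φ k) y)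
          ≈⟨ +-cong (*-congˡ (dot-δ i (λ k → ℓ (φ k) y)))
                    (*-congˡ (trans (dot-δ j (λ k → ℓ (φ k) y)) (reflexive (≡.cong (λ f → ℓ f y) (≡.sym φi≡φj))))) ⟩
        1# * ℓ (φ i) y + - 1# * ℓ (φ i) y
          ≈⟨ solve 2 (λ o a → o :* a :+ (:- o) :* a := con (+ 0)) refl 1# (ℓ (φ i) y) ⟩
        0# ∎

    -- The direction `w` witnesses independence: the old facets vanish on it and `g` does not, so
    -- evaluating a relation at `w` isolates the coefficient of `g`.
    extend-frame : ∀ {r x x′ w} (F : Frame r x) → (∀ i → ℓ (Frame.φ F i) x′ ≈ 0#) →
                   (∀ i → ℓ (Frame.φ F i) w ≈ 0#) → ∀ g → ℓ g x′ ≈ 0# → ¬ ℓ g w ≈ 0# → Frame (suc r) x′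
    extend-frame {r} {w = w} F tight′ w⊥ g g-tight gw≉0 = record
      { φ           = g ∷ φ
      ; tight       = λ { zero → g-tight ; (suc i) → tight′ i }
      ; independent = λ h rel → λ
          { zero    → h₀≈0 h rel
          ; (suc i) → independent (h ∘ suc) (λ y → begin
              sum (λ i → h (suc i) * ℓ (φ i) y)
                ≈⟨ +-identityˡ _ ⟨
              0# + sum (λ i → h (suc i) * ℓ (φ i) y)
                ≈⟨ +-congʳ (trans (*-congʳ (h₀≈0 h rel)) (zeroˡ _)) ⟨
              h zero * ℓ g y + sum (λ i → h (suc i) * ℓ (φ i) y)
                ≈⟨ sum-suc _ ⟨
              sum (λ i → h i * ℓ ((g ∷ φ) i) y)
                ≈⟨ rel y ⟩
              0# ∎) i
          }
      }
      where
      open Frame F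
      h₀≈0 : ∀ h → (∀ y → sum (λ i → h i * ℓ ((g ∷ φ) i) y) ≈ 0#) → h zero ≈ 0#
      h₀≈0 h rel = [ (λ eq → eq) , (λ gw≈0 → ⊥-elim (gw≉0 gw≈0)) ]′ (noZeroDivisors (begin
        h zero * ℓ g w
          ≈⟨ +-identityʳ _ ⟨
        h zero * ℓ g w + 0#
          ≈⟨ +-congˡ (sum-zero (λ i → trans (*-congˡ (w⊥ i)) (zeroʳ _))) ⟨
        h zero * ℓ g w + sum (λ i → h (suc i) * ℓ (φ i) w)
          ≈⟨ sum-suc _ ⟨
        sum (λ i → h i * ℓ ((g ∷ φ) i) w)
          ≈⟨ rel w ⟩
        0# ∎))

    -- The ray x + s w, rescaled, at the point where it leaves the cone through facet g.
    push : Vec → Vec → Fin N → Vec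
    push x w g j = (- ℓ g w) * x j + ℓ g x * w j

    ℓ-push : ∀ x w g f → ℓ f (push x w g) ≈ (- ℓ g w) * ℓ f x + ℓ g x * ℓ f w
    ℓ-push x w g f = dot-lin₂ (M f) (- ℓ g w) x (ℓ g x) w

    ℓ-push-self : ∀ x w g → ℓ g (push x w g) ≈ 0#
    ℓ-push-self x w g = trans (ℓ-push x w g g)
      (solve 2 (λ a b → (:- b) :* a :+ a :* b := con (+ 0)) refl (ℓ g x) (ℓ g w))

    ℓ-push-tight : ∀ x w g f → ℓ f x ≈ 0# → ℓ f w ≈ 0# → ℓ f (push x w g) ≈ 0#
    ℓ-push-tight x w g f x⊥ w⊥ = trans (ℓ-push x w g f)
      (trans (+-cong (trans (*-congˡ x⊥) (zeroʳ _)) (trans (*-congˡ w⊥) (zeroʳ _))) (+-identityʳ 0#))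

    -- The ratio test of the simplex method: among the facets decreasing along `w`, minimise
    -- `ℓ f x / (- ℓ f w)`. A minimum of 0 is possible; then `g` is already tight at `x`.
    leaving-facet : ∀ x w → InK x → (∃ λ f → Pos (- ℓ f w)) → ∃ λ g → Pos (- ℓ g w) × InK (push x w g)
    leaving-facet x w x∈K some
      with argmin (λ f → ℓ f x) (λ f → - ℓ f w) (λ f → Pos (- ℓ f w)) (λ f → pos? _) (λ f lt → lt) some
    ... | g , g<0 , least = g , g<0 , λ f → NonNeg-resp (sym (ℓ-push x w g f)) (inside f (pos? (- ℓ f w)))
      where
      inside : ∀ f → Dec (Pos (- ℓ f w)) → NonNeg ((- ℓ g w) * ℓ f x + ℓ g x * ℓ f w)
      inside f (yes f<0) = NonNeg-resp
        (solve 4 (λ a b c d → a :* (:- b) :- c :* (:- d) := (:- b) :* a :+ c :* d) refl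
          (ℓ f x) (ℓ g w) (ℓ g x) (ℓ f w)) (least f f<0)
      inside f (no f≮0) = NonNeg-+ (NonNeg-* (inj₁ g<0) (x∈K f))
        (NonNeg-* (x∈K g) (NonNeg-resp (-‿involutive _) (¬Pos⇒NonNeg-neg f≮0)))

    -- `Good` stands for lying over a fixed extreme generator, and `split` for its
    -- indecomposability. The factors a, b, c are there because points are known only up to positive
    -- scaling.
    module _ (Good : Vec → Set)
      (split : ∀ x y z {a b c} → Pos a → Pos b → Pos c → InK y → InK z →
               (∀ j → a * x j ≈ b * y j + c * z j) → Good x → Good y ⊎ Good z) where

      State : ℕ → Set
      State r = ∃ λ x → InK x × Good x × Frame r x

      -- For r < D some nonzero `w` is annihilated by `e` and the r facets of the frame. By
      -- pointedness both `w` and its opposite leave the cone, each through a facet that is nonzero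
      -- on `w` and hence independent of the frame.
      improve : ∀ {r} → r ℕ.< D → State r → State (suc r)
      improve {r} r<D (x , x∈K , good , F) = go
        (leaving-facet x w x∈K (pointed w w≉0 e⊥w))
        (leaving-facet x w⁻ x∈K (pointed w⁻ w⁻≉0 (trans (dot-neg e) (trans (-‿cong e⊥w) -0#≈0#))))
        where
        open Frame F

        -- A dependence among the D + 1 columns is a kernel vector of the r + 1 rows.
        solution : ∃ λ (w : Vec) → (∃ λ j → ¬ w j ≈ 0#) × (∀ i → dot w (λ j → (e ∷ (M ∘ φ)) i j) ≈ 0#)
        solution = dependence (s≤s r<D) (λ j i → (e ∷ (M ∘ φ)) i j)

        w w⁻ : Vec
        w = proj₁ solution
        w⁻ j = (- 1#) * w j

        w≉0 : ∃ λ j → ¬ w j ≈ 0#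
        w≉0 = proj₁ (proj₂ solution)

        -1*≈ : ∀ a → (- 1#) * a ≈ - a
        -1*≈ a = trans (sym (-‿distribˡ-* 1# a)) (-‿cong (*-identityˡ a))

        w⁻≉0 : ∃ λ j → ¬ w⁻ j ≈ 0#
        w⁻≉0 = proj₁ w≉0 , λ eq → proj₂ w≉0 (begin
          w _         ≈⟨ -‿involutive _ ⟨
          - (- w _)   ≈⟨ -‿cong (trans (sym (-1*≈ _)) eq) ⟩
          - 0#        ≈⟨ -0#≈0# ⟩
          0#          ∎)

        dot-neg : ∀ a → dot a w⁻ ≈ - dot a w
        dot-neg a = trans (dot-scale a (- 1#) w) (-1*≈ _)

        e⊥w : dot e w ≈ 0#
        e⊥w = trans (dot-comm e w) (proj₂ (proj₂ solution) zero)

        φ⊥w : ∀ i → ℓ (φ i) w ≈ 0#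
        φ⊥w i = trans (dot-comm (M (φ i)) w) (proj₂ (proj₂ solution) (suc i))

        φ⊥w⁻ : ∀ i → ℓ (φ i) w⁻ ≈ 0#
        φ⊥w⁻ i = trans (dot-neg (M (φ i))) (trans (-‿cong (φ⊥w i)) -0#≈0#)

        negative⇒≉0 : ∀ {a} → Pos (- a) → ¬ a ≈ 0#
        negative⇒≉0 a<0 a≈0 = Pos⇒≉0 a<0 (trans (-‿cong a≈0) -0#≈0#)

        pushed : ∀ v → (∀ i → ℓ (φ i) v ≈ 0#) → ∀ g → Pos (- ℓ g v) → InK (push x v g) → Good (push x v g) → State (suc r)
        pushed v φ⊥v g g<0 ∈K good′ = push x v g , ∈K , good′ ,
          extend-frame F (λ i → ℓ-push-tight x v g (φ i) (tight i) (φ⊥v i)) φ⊥v g (ℓ-push-self x v g) (negative⇒≉0 g<0)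

        go : (∃ λ g → Pos (- ℓ g w) × InK (push x w g)) → (∃ λ g → Pos (- ℓ g w⁻) × InK (push x w⁻ g)) → State (suc r)
        go (g , g<0 , ∈K) (g′ , g′<0 , ∈K′) with x∈K g | x∈K g′
        -- An exit facet already tight at `x` extends the frame without any move.
        ... | inj₂ gx≈0 | _ = x , x∈K , good , extend-frame F tight φ⊥w g gx≈0 (negative⇒≉0 g<0)
        ... | inj₁ _ | inj₂ g′x≈0 = x , x∈K , good , extend-frame F tight φ⊥w⁻ g′ g′x≈0 (negative⇒≉0 g′<0)
        -- Weights `ℓ g′ x` and `ℓ g x` on the two pushed points make the contributions of `w` and
        -- `w⁻` cancel, leaving a positive multiple of `x`.
        ... | inj₁ gx>0 | inj₁ g′x>0 =
          [ pushed w φ⊥w g g<0 ∈K , pushed w⁻ φ⊥w⁻ g′ g′<0 ∈K′ ]′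
            (split x (push x w g) (push x w⁻ g′)
              (Pos-+ (Pos-* g′x>0 g<0) (Pos-* gx>0 g′<0)) g′x>0 gx>0 ∈K ∈K′
              (λ j → trans
                (solve 6 (λ p′ p q q′ xj wj → (p′ :* (:- q) :+ p :* (:- q′)) :* xj
                   := p′ :* ((:- q) :* xj :+ p :* wj) :+ p :* ((:- q′) :* xj :+ p′ :* (:- wj))) refl
                   (ℓ g′ x) (ℓ g x) (ℓ g w) (ℓ g′ w⁻) (x j) (w j))
                (+-congˡ (*-congˡ (+-congˡ (*-congˡ (sym (-1*≈ (w j))))))))
              good)

      vertex : ∀ x → InK x → Good x → State D
      vertex x x∈K good = go D 0 (ℕP.+-identityʳ D) (x , x∈K , good , record
        { φ = λ () ; tight = λ () ; independent = λ _ _ () })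
        where
        go : ∀ n r → n ℕ.+ r ≡ D → State r → State D
        go zero    r ≡.refl S = S
        go (suc n) r eq     S = go n (suc r) (≡.trans (ℕP.+-suc n r) eq)
          (improve (ℕP.≤-trans (s≤s (ℕP.m≤n+m r n)) (ℕP.≤-reflexive eq)) S)

    module Objective (c : Vec) {x : Vec} (F : Frame D x) (ex>0 : Pos (dot e x)) where
      open Frame F

      family : Fin (suc (suc D)) → Vec
      family = c ∷ (e ∷ (M ∘ φ))

      -- The D + 2 functionals c, e and the D tight facets live in dimension D + 1.
      relation : ∃ λ g → (∃ λ k → ¬ g k ≈ 0#) × (∀ j → sum (λ k → g k * family k j) ≈ 0#)
      relation = dependence ℕP.≤-refl family

      g : Fin (suc (suc D)) → Carrier
      g = proj₁ relation

      expand : ∀ y → g zero * dot c y + (g (suc zero) * dot e y + sum (λ i → g (suc (suc i)) * ℓ (φ i) y)) ≈ 0#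
      expand y = begin
        g zero * dot c y + (g (suc zero) * dot e y + sum (λ i → g (suc (suc i)) * ℓ (φ i) y))
          ≈⟨ trans (sum-suc _) (+-congˡ (sum-suc _)) ⟨
        sum (λ k → g k * dot (family k) y)
          ≈⟨ dot-combination g family y ⟩
        dot (λ j → sum (λ k → g k * family k j)) y
          ≈⟨ sum-zero (λ j → trans (*-congʳ (proj₂ (proj₂ relation) j)) (zeroˡ _)) ⟩
        0# ∎

      -- In a relation without `c`, evaluation at `x` kills the tight facets and forces the
      -- coefficient of `e` to be 0; independence of the frame then kills the rest.
      g₀≉0 : ¬ g zero ≈ 0#
      g₀≉0 g₀≈0 = proj₂ (proj₁ (proj₂ relation)) (all≈0 (proj₁ (proj₁ (proj₂ relation))))
        where
        drop-c : ∀ y → g (suc zero) * dot e y + sum (λ i → g (suc (suc i)) * ℓ (φ i) y) ≈ 0#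
        drop-c y = trans (sym (trans (+-congʳ (trans (*-congʳ g₀≈0) (zeroˡ _))) (+-identityˡ _))) (expand y)

        g₁≈0 : g (suc zero) ≈ 0#
        g₁≈0 = [ (λ eq → eq) , (λ ex≈0 → ⊥-elim (Pos⇒≉0 ex>0 ex≈0)) ]′ (noZeroDivisors
          (trans (sym (trans (+-congˡ (sum-zero λ i → trans (*-congˡ (tight i)) (zeroʳ _))) (+-identityʳ _))) (drop-c x)))

        all≈0 : ∀ k → g k ≈ 0#
        all≈0 zero          = g₀≈0
        all≈0 (suc zero)    = g₁≈0
        all≈0 (suc (suc i)) = independent (λ i → g (suc (suc i)))
          (λ y → trans (sym (trans (+-congʳ (trans (*-congʳ g₁≈0) (zeroˡ _))) (+-identityˡ _))) (drop-c y)) i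

      -- Coefficient of the i-th tight facet in g₀² times `c`. The sign of g₀ is unknown, so the
      -- relation is multiplied by g₀ once more to put a positive factor on `c`.
      λᵢ : Fin D → Carrier
      λᵢ i = - (g zero * g (suc (suc i)))

      -- Objective value `c`/`e` at `y` minus the one at `x`, with denominators cleared.
      gap : Vec → Carrier
      gap y = dot c y * dot e x - dot c x * dot e y

      -- c minus a multiple of e vanishes at x, so it is a combination of the tight facets.
      gap-expansion : ∀ y → g zero * g zero * gap y ≈ dot e x * sum (λ i → λᵢ i * ℓ (φ i) y)
      gap-expansion y = begin
        g zero * g zero * gap y
          ≈⟨ solve 7 (λ g₀ g₁ cx ex cy ey S → g₀ :* g₀ :* (cy :* ex :- cx :* ey)
               := ex :* (:- (g₀ :* S)) :+ g₀ :* (ex :* (g₀ :* cy :+ (g₁ :* ey :+ S))) :- g₀ :* (ey :* (g₀ :* cx :+ g₁ :* ex)))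
               refl (g zero) (g (suc zero)) (dot c x) (dot e x) (dot c y) (dot e y) S ⟩
        dot e x * (- (g zero * S)) + g zero * (dot e x * (g zero * dot c y + (g (suc zero) * dot e y + S)))
          - g zero * (dot e y * (g zero * dot c x + g (suc zero) * dot e x))
          ≈⟨ +-cong (+-congˡ (*-congˡ (*-congˡ (expand y)))) (-‿cong (*-congˡ (*-congˡ at-x))) ⟩
        dot e x * (- (g zero * S)) + g zero * (dot e x * 0#) - g zero * (dot e y * 0#)
          ≈⟨ solve 4 (λ ex ey g₀ S → ex :* (:- (g₀ :* S)) :+ g₀ :* (ex :* con (+ 0)) :- g₀ :* (ey :* con (+ 0))
               := ex :* ((:- g₀) :* S)) refl (dot e x) (dot e y) (g zero) S ⟩
        dot e x * (- g zero * S)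
          ≈⟨ *-congˡ (*-sum (- g zero) _) ⟩
        dot e x * sum (λ i → - g zero * (g (suc (suc i)) * ℓ (φ i) y))
          ≈⟨ *-congˡ (sum-cong λ i → solve 3 (λ a b c → (:- a) :* (b :* c) := (:- (a :* b)) :* c) refl
               (g zero) (g (suc (suc i))) (ℓ (φ i) y)) ⟩
        dot e x * sum (λ i → λᵢ i * ℓ (φ i) y) ∎
        where
        S : Carrier
        S = sum (λ i → g (suc (suc i)) * ℓ (φ i) y)
        at-x : g zero * dot c x + g (suc zero) * dot e x ≈ 0#
        at-x = trans (+-congˡ (sym (trans (+-congˡ (sum-zero λ i → trans (*-congˡ (tight i)) (zeroʳ _))) (+-identityʳ _)))) (expand x)

      -- The values `ℓ (φ i) y` are nonnegative, so if every facet with positive coefficient were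
      -- tight at `y`, the expansion of the gap could not be positive.
      positive-side : ∀ y → InK y → Pos (gap y) → ∃ λ i → Pos (λᵢ i) × ¬ ℓ (φ i) y ≈ 0#
      positive-side y y∈K gap>0 with any? (λ i → pos? (λᵢ i) ×-dec ¬? (0≟ (ℓ (φ i) y)))
      ... | yes found = found
      ... | no  none  = ⊥-elim (Pos-neg⇒¬NonNeg (Pos-resp (sym (-‿involutive _)) total>0)
          (NonNeg-resp (begin
              dot e x * sum (λ i → - λᵢ i * ℓ (φ i) y)
                ≈⟨ *-congˡ (sum-cong λ i → solve 2 (λ a b → (:- a) :* b := (:- con (+ 1)) :* (a :* b)) refl (λᵢ i) (ℓ (φ i) y)) ⟩
              -- `1# + 0#` is how the solver interprets the numeral 1.
              dot e x * sum (λ i → (- (1# + 0#)) * (λᵢ i * ℓ (φ i) y))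
                ≈⟨ *-congˡ (*-sum (- (1# + 0#)) _) ⟨
              dot e x * ((- (1# + 0#)) * sum (λ i → λᵢ i * ℓ (φ i) y))
                ≈⟨ solve 2 (λ a b → a :* ((:- con (+ 1)) :* b) := :- (a :* b)) refl _ _ ⟩
              - (dot e x * sum (λ i → λᵢ i * ℓ (φ i) y)) ∎)
            (NonNeg-* (inj₁ ex>0) (NonNeg-sum λ i → term i (pos? (λᵢ i)) (0≟ (ℓ (φ i) y))))))
        where
        total>0 : Pos (dot e x * sum (λ i → λᵢ i * ℓ (φ i) y))
        total>0 = Pos-resp (gap-expansion y) (Pos-* (Pos-square g₀≉0) gap>0)
        term : ∀ i → Dec (Pos (λᵢ i)) → Dec (ℓ (φ i) y ≈ 0#) → NonNeg (- λᵢ i * ℓ (φ i) y)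
        term i _          (yes eq) = inj₂ (trans (*-congˡ eq) (zeroʳ _))
        term i (yes λ>0)  (no neq) = ⊥-elim (none (i , λ>0 , neq))
        term i (no λ≯0)   (no _)   = NonNeg-* (¬Pos⇒NonNeg-neg λ≯0) (y∈K (φ i))

      negative-side : ∀ y → InK y → Pos (- gap y) → ∃ λ i → ¬ Pos (λᵢ i) × ¬ ℓ (φ i) y ≈ 0#
      negative-side y y∈K gap<0 with any? (λ i → ¬? (pos? (λᵢ i)) ×-dec ¬? (0≟ (ℓ (φ i) y)))
      ... | yes found = found
      ... | no  none  = ⊥-elim (Pos-neg⇒¬NonNeg
          (Pos-resp (trans (sym (-‿distribʳ-* _ _)) (-‿cong (gap-expansion y))) (Pos-* (Pos-square g₀≉0) gap<0))
          (NonNeg-* (inj₁ ex>0) (NonNeg-sum λ i → term i (pos? (λᵢ i)) (0≟ (ℓ (φ i) y)))))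
        where
        term : ∀ i → Dec (Pos (λᵢ i)) → Dec (ℓ (φ i) y ≈ 0#) → NonNeg (λᵢ i * ℓ (φ i) y)
        term i _          (yes eq) = inj₂ (trans (*-congˡ eq) (zeroʳ _))
        term i (no λ≯0)   (no neq) = ⊥-elim (none (i , λ≯0 , neq))
        term i (yes λ>0)  (no _)   = NonNeg-* (inj₁ λ>0) (y∈K (φ i))

-- The group ring ℤ[ℝ]

module RealOrder (ℝ : RealField) where
  open RealField ℝ using (isTotalOrder; +-mono; isCommutativeRing)
  open IsTotalOrder isTotalOrder using (total; antisym) renaming (refl to ≤-refl; trans to ≤-trans)

  ring : CommutativeRing 0ℓ 0ℓ
  ring = record { isCommutativeRing = isCommutativeRing }

  open CommutativeRing ring public using (Carrier; _+_; -_; _-_; 0#; -‿inverseˡ)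
  infix 4 _≤_ _<_
  _≤_ : Carrier → Carrier → Set
  _≤_ = RealField._≤_ ℝ

  private module S = IntegerSolver ring

  private
    inj₁≢inj₂ : ∀ {A B : Set} {x : A} {y : B} → inj₁ x ≢ inj₂ y
    inj₁≢inj₂ ()

  -- The choice made by `total` depends on the pair only, so it must agree on x , x and its swap.
  _≟_ : (x y : Carrier) → Dec (x ≡ y)
  x ≟ y with total x y in eq₁ | total y x in eq₂
  ... | inj₁ x≤y | inj₁ y≤x = yes (antisym x≤y y≤x)
  ... | inj₂ y≤x | inj₂ x≤y = yes (antisym x≤y y≤x)
  ... | inj₁ _   | inj₂ _   = no λ { ≡.refl → inj₁≢inj₂ (≡.trans (≡.sym eq₁) eq₂) }
  ... | inj₂ _   | inj₁ _   = no λ { ≡.refl → inj₁≢inj₂ (≡.trans (≡.sym eq₂) eq₁) }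

  _<_ : Carrier → Carrier → Set
  x < y = x ≤ y × x ≢ y

  compare : ∀ x y → x < y ⊎ x ≡ y ⊎ y < x
  compare x y with x ≟ y | total x y
  ... | yes x≡y | _        = inj₂ (inj₁ x≡y)
  ... | no  x≢y | inj₁ x≤y = inj₁ (x≤y , x≢y)
  ... | no  x≢y | inj₂ y≤x = inj₂ (inj₂ (y≤x , x≢y ∘ ≡.sym))

  <-≤-trans : ∀ {x y z} → x < y → y ≤ z → x < z
  <-≤-trans (x≤y , x≢y) y≤z = ≤-trans x≤y y≤z , λ { ≡.refl → x≢y (antisym x≤y y≤z) }

  <⇒≱ : ∀ {x y} → x < y → ¬ y ≤ x
  <⇒≱ (x≤y , x≢y) y≤x = x≢y (antisym x≤y y≤x)

  ≤⊎> : ∀ x y → x ≤ y ⊎ y < x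
  ≤⊎> x y with compare x y
  ... | inj₁ x<y            = inj₁ (proj₁ x<y)
  ... | inj₂ (inj₁ ≡.refl)  = inj₁ ≤-refl
  ... | inj₂ (inj₂ y<x)     = inj₂ y<x

  cancel : ∀ x y → x + (y - x) ≡ y
  cancel = S.solve 2 (λ x y → x S.:+ (y S.:- x) S.:= y) ≡.refl

  cancel′ : ∀ x y → (x + y) - x ≡ y
  cancel′ = S.solve 2 (λ x y → (x S.:+ y) S.:- x S.:= y) ≡.refl

  assoc-sub : ∀ g h k → g - (h + k) ≡ (g - h) - k
  assoc-sub = S.solve 3 (λ g h k → g S.:- (h S.:+ k) S.:= (g S.:- h) S.:- k) ≡.refl

  swap-sub : ∀ g h k → k ≡ g - h → h ≡ g - k
  swap-sub g h _ ≡.refl = S.solve 2 (λ g h → h S.:= g S.:- (g S.:- h)) ≡.refl g h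

  sub-zero : ∀ g → g - 0# ≡ g
  sub-zero = S.solve 1 (λ g → g S.:- S.con (+ 0) S.:= g) ≡.refl

  +-monoʳ-< : ∀ {x y} z → x < y → x + z < y + z
  +-monoʳ-< {x} {y} z (x≤y , x≢y) = +-mono x y z x≤y , λ eq → x≢y
    (≡.trans (≡.sym (back x)) (≡.trans (≡.cong (_- z) eq) (back y)))
    where
    back : ∀ w → (w + z) - z ≡ w
    back w = S.solve 2 (λ w z → (w S.:+ z) S.:- z S.:= w) ≡.refl w z

  -- In a product, exponent `h` of one factor meets `g - h` of the other. If `h` is below the
  -- leading exponent `g₁`, its partner lies above the leading exponent `g₂` and has coefficient 0.
  ≤-<⇒residual : ∀ {g₁ g₂ g h} → g₁ + g₂ ≤ g → h < g₁ → g₂ < (g - h)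
  ≤-<⇒residual {g₁} {g₂} {g} {h} le lt = <-≤-trans
    (≡.subst (_< (g₁ + (g₂ - h))) (cancel h g₂) (+-monoʳ-< (g₂ - h) lt))
    (≡.subst (_≤ (g - h)) (shuffle g₁ g₂ h) (+-mono _ _ (- h) le))
    where
    shuffle : ∀ a b c → (a + b) - c ≡ a + (b - c)
    shuffle = S.solve 3 (λ a b c → (a S.:+ b) S.:- c S.:= a S.:+ (b S.:- c)) ≡.refl

  <-≤⇒residual : ∀ {g₁ g₂ g h} → (g₁ + g₂) < g → h ≤ g₁ → g₂ < (g - h)
  <-≤⇒residual {g₁} {g₂} {g} {h} lt le with compare h g₁
  ... | inj₁ h<g₁           = ≤-<⇒residual (proj₁ lt) h<g₁
  ... | inj₂ (inj₁ ≡.refl)  = ≡.subst (_< (g - h)) (cancel′ h g₂) (+-monoʳ-< (- h) lt)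
  ... | inj₂ (inj₂ g₁<h)    = ⊥-elim (<⇒≱ g₁<h le)

-- Formal sums Σ c t^g with c ∈ ℤ and g ∈ ℝ: the group ring ℤ[ℝ].
module GroupRing (ℝ : RealField) where
  open List using (List; []; _∷_; _++_; map)
  open RealOrder ℝ public

  Sum : Set
  Sum = List (Carrier × ℤ)

  -- A formal sum as a linear functional on functions of the exponent. Lists may repeat exponents or
  -- contain zero terms, so statements pass through these functionals; the product laws then become
  -- exchanges of summation.
  lin : Sum → (Carrier → ℤ) → ℤ
  lin []            F = + 0
  lin ((h , c) ∷ p) F = c ℤ.* F h ℤ.+ lin p F

  ind : Carrier → Carrier → ℤ
  ind g h with h ≟ g
  ... | yes _ = + 1
  ... | no  _ = + 0

  ind-diag : ∀ g → ind g g ≡ + 1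
  ind-diag g with g ≟ g
  ... | yes _  = ≡.refl
  ... | no g≢g = ⊥-elim (g≢g ≡.refl)

  ind-off : ∀ {g h} → h ≢ g → ind g h ≡ + 0
  ind-off {g} {h} h≢g with h ≟ g
  ... | yes h≡g = ⊥-elim (h≢g h≡g)
  ... | no  _   = ≡.refl

  coef : Sum → Carrier → ℤ
  coef p g = lin p (ind g)

  lin-cong : ∀ p {F F′} → (∀ h → F h ≡ F′ h) → lin p F ≡ lin p F′
  lin-cong []            eq = ≡.refl
  lin-cong ((h , c) ∷ p) eq = ≡.cong₂ ℤ._+_ (≡.cong (c ℤ.*_) (eq h)) (lin-cong p eq)

  lin-++ : ∀ p q F → lin (p ++ q) F ≡ lin p F ℤ.+ lin q F
  lin-++ []            q F = ≡.sym (ℤP.+-identityˡ _)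
  lin-++ ((h , c) ∷ p) q F = ≡.trans (≡.cong (λ z → c ℤ.* F h ℤ.+ z) (lin-++ p q F)) (≡.sym (ℤP.+-assoc (c ℤ.* F h) _ _))

  open +-*-Solver

  lin-+ : ∀ p F F′ → lin p (λ h → F h ℤ.+ F′ h) ≡ lin p F ℤ.+ lin p F′
  lin-+ []            F F′ = ≡.refl
  lin-+ ((h , c) ∷ p) F F′ = ≡.trans (≡.cong (λ z → c ℤ.* (F h ℤ.+ F′ h) ℤ.+ z) (lin-+ p F F′))
    (solve 5 (λ c x y l l′ → c :* (x :+ y) :+ (l :+ l′) := (c :* x :+ l) :+ (c :* y :+ l′)) ≡.refl c (F h) (F′ h) (lin p F) (lin p F′))

  lin-* : ∀ p k F → lin p (λ h → k ℤ.* F h) ≡ k ℤ.* lin p F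
  lin-* []            k F = ≡.sym (ℤP.*-zeroʳ k)
  lin-* ((h , c) ∷ p) k F = ≡.trans (≡.cong (λ z → c ℤ.* (k ℤ.* F h) ℤ.+ z) (lin-* p k F))
    (solve 4 (λ c k x l → c :* (k :* x) :+ k :* l := k :* (c :* x :+ l)) ≡.refl c k (F h) (lin p F))

  lin-0 : ∀ p → lin p (λ _ → + 0) ≡ + 0
  lin-0 []            = ≡.refl
  lin-0 ((h , c) ∷ p) = ≡.cong₂ ℤ._+_ (ℤP.*-zeroʳ c) (lin-0 p)

  lin-swap : ∀ p q (F : Carrier → Carrier → ℤ) →
             lin p (λ h → lin q (F h)) ≡ lin q (λ k → lin p (λ h → F h k))
  lin-swap []            q F = ≡.sym (lin-0 q)
  lin-swap ((h , c) ∷ p) q F = ≡.trans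
    (≡.cong₂ ℤ._+_ (≡.sym (lin-* q c (F h))) (lin-swap p q F)) (≡.sym (lin-+ q _ _))

  negate : Sum → Sum
  negate = map (λ (h , c) → h , ℤ.- c)

  lin-negate : ∀ p F → lin (negate p) F ≡ ℤ.- lin p F
  lin-negate []            F = ≡.refl
  lin-negate ((h , c) ∷ p) F = ≡.trans (≡.cong (λ z → (ℤ.- c) ℤ.* F h ℤ.+ z) (lin-negate p F))
    (solve 3 (λ c x l → (:- c) :* x :+ (:- l) := :- (c :* x :+ l)) ≡.refl c (F h) (lin p F))

  shift : Carrier → ℤ → Sum → Sum
  shift h c = map (λ (k , e) → h + k , c ℤ.* e)

  lin-shift : ∀ h c q F → lin (shift h c q) F ≡ c ℤ.* lin q (λ k → F (h + k))
  lin-shift h c []            F = ≡.sym (ℤP.*-zeroʳ c)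
  lin-shift h c ((k , e) ∷ q) F = ≡.trans (≡.cong (λ z → c ℤ.* e ℤ.* F (h + k) ℤ.+ z) (lin-shift h c q F))
    (solve 4 (λ c e x l → c :* e :* x :+ c :* l := c :* (e :* x :+ l)) ≡.refl c e (F (h + k)) (lin q (λ k → F (h + k))))

  infixl 7 _⊛_
  _⊛_ : Sum → Sum → Sum
  []            ⊛ q = []
  ((h , c) ∷ p) ⊛ q = shift h c q ++ p ⊛ q

  lin-⊛ : ∀ p q F → lin (p ⊛ q) F ≡ lin p (λ h → lin q (λ k → F (h + k)))
  lin-⊛ []            q F = ≡.refl
  lin-⊛ ((h , c) ∷ p) q F = ≡.trans (lin-++ (shift h c q) (p ⊛ q) F)
    (≡.cong₂ ℤ._+_ (lin-shift h c q F) (lin-⊛ p q F))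

  ind-+ : ∀ g h k → ind g (h + k) ≡ ind (g - h) k
  ind-+ g h k with k ≟ (g - h)
  ... | yes ≡.refl = ≡.trans (≡.cong (ind g) (cancel h g)) (ind-diag g)
  ... | no  k≢     = ind-off λ { ≡.refl → k≢ (≡.sym (cancel′ h k)) }

  coef-⊛ : ∀ p q g → coef (p ⊛ q) g ≡ lin p (λ h → coef q (g - h))
  coef-⊛ p q g = ≡.trans (lin-⊛ p q (ind g)) (lin-cong p λ h → lin-cong q (ind-+ g h))

  infix 4 _≈_
  -- A record and not a bare function type, so that unification can recover `p` and `q`.
  record _≈_ (p q : Sum) : Set where
    constructor mk
    field at : ∀ g → coef p g ≡ coef q g
  open _≈_ public

  ind-swap : ∀ g h k → ind (g - h) k ≡ ind (g - k) h
  ind-swap g h k with k ≟ (g - h)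
  ... | yes eq = ≡.sym (≡.trans (≡.cong (λ x → ind x h) (≡.sym (swap-sub g h k eq))) (ind-diag h))
  ... | no  k≢ = ≡.sym (ind-off (k≢ ∘ swap-sub g k h))

  ⊛-comm : ∀ p q → p ⊛ q ≈ q ⊛ p
  at (⊛-comm p q) g = begin
    coef (p ⊛ q) g                               ≡⟨ coef-⊛ p q g ⟩
    lin p (λ h → lin q (λ k → ind (g - h) k))    ≡⟨ lin-swap p q _ ⟩
    lin q (λ k → lin p (λ h → ind (g - h) k))    ≡⟨ lin-cong q (λ k → lin-cong p λ h → ind-swap g h k) ⟩
    lin q (λ k → lin p (λ h → ind (g - k) h))    ≡⟨ coef-⊛ q p g ⟨
    coef (q ⊛ p) g                               ∎
    where open ≡.≡-Reasoning

  ⊛-congˡ : ∀ p {q q′} → q ≈ q′ → p ⊛ q ≈ p ⊛ q′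
  at (⊛-congˡ p {q} {q′} q≈q′) g = ≡.trans (coef-⊛ p q g)
    (≡.trans (lin-cong p λ h → at q≈q′ (g - h)) (≡.sym (coef-⊛ p q′ g)))

  ≈-refl : ∀ {p} → p ≈ p
  at ≈-refl g = ≡.refl

  ≈-trans : ∀ {p q r} → p ≈ q → q ≈ r → p ≈ r
  at (≈-trans p≈q q≈r) g = ≡.trans (at p≈q g) (at q≈r g)

  ≈-sym : ∀ {p q} → p ≈ q → q ≈ p
  at (≈-sym p≈q) g = ≡.sym (at p≈q g)

  ⊛-cong : ∀ {p p′ q q′} → p ≈ p′ → q ≈ q′ → p ⊛ q ≈ p′ ⊛ q′
  ⊛-cong {p} {p′} {q} {q′} p≈p′ q≈q′ = ≈-trans (⊛-congˡ p q≈q′)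
    (≈-trans (⊛-comm p q′) (≈-trans (⊛-congˡ q′ p≈p′) (⊛-comm q′ p′)))

  ⊛-assoc : ∀ p q r → (p ⊛ q) ⊛ r ≈ p ⊛ (q ⊛ r)
  at (⊛-assoc p q r) g = begin
    coef ((p ⊛ q) ⊛ r) g                                 ≡⟨ coef-⊛ (p ⊛ q) r g ⟩
    lin (p ⊛ q) (λ h → coef r (g - h))                   ≡⟨ lin-⊛ p q _ ⟩
    lin p (λ h → lin q (λ k → coef r (g - (h + k))))     ≡⟨ lin-cong p (λ h → lin-cong q λ k → ≡.cong (coef r) (assoc-sub g h k)) ⟩
    lin p (λ h → lin q (λ k → coef r ((g - h) - k)))     ≡⟨ lin-cong p (λ h → coef-⊛ q r (g - h)) ⟨
    lin p (λ h → coef (q ⊛ r) (g - h))                   ≡⟨ coef-⊛ p (q ⊛ r) g ⟨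
    coef (p ⊛ (q ⊛ r)) g                                 ∎
    where open ≡.≡-Reasoning

  one : Sum
  one = (0# , + 1) ∷ []

  ⊛-identityˡ : ∀ p → one ⊛ p ≈ p
  at (⊛-identityˡ p) g = begin
    coef (one ⊛ p) g                        ≡⟨ coef-⊛ one p g ⟩
    + 1 ℤ.* coef p (g - 0#) ℤ.+ + 0         ≡⟨ ℤP.+-identityʳ _ ⟩
    + 1 ℤ.* coef p (g - 0#)                 ≡⟨ ℤP.*-identityˡ _ ⟩
    coef p (g - 0#)                         ≡⟨ ≡.cong (coef p) (sub-zero g) ⟩
    coef p g                                ∎
    where open ≡.≡-Reasoning

  ⊛-distribˡ : ∀ p q r → p ⊛ (q ++ r) ≈ p ⊛ q ++ p ⊛ r
  at (⊛-distribˡ p q r) g = begin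
    coef (p ⊛ (q ++ r)) g                                          ≡⟨ coef-⊛ p (q ++ r) g ⟩
    lin p (λ h → coef (q ++ r) (g - h))                            ≡⟨ lin-cong p (λ h → lin-++ q r _) ⟩
    lin p (λ h → coef q (g - h) ℤ.+ coef r (g - h))                ≡⟨ lin-+ p _ _ ⟩
    lin p (λ h → coef q (g - h)) ℤ.+ lin p (λ h → coef r (g - h))  ≡⟨ ≡.cong₂ ℤ._+_ (coef-⊛ p q g) (coef-⊛ p r g) ⟨
    coef (p ⊛ q) g ℤ.+ coef (p ⊛ r) g                              ≡⟨ lin-++ (p ⊛ q) (p ⊛ r) _ ⟨
    coef (p ⊛ q ++ p ⊛ r) g                                        ∎
    where open ≡.≡-Reasoning

  ++-cong : ∀ {p p′ q q′} → p ≈ p′ → q ≈ q′ → p ++ q ≈ p′ ++ q′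
  at (++-cong {p} {p′} {q} {q′} p≈p′ q≈q′) g =
    ≡.trans (lin-++ p q _) (≡.trans (≡.cong₂ ℤ._+_ (at p≈p′ g) (at q≈q′ g)) (≡.sym (lin-++ p′ q′ _)))

  ++-comm : ∀ p q → p ++ q ≈ q ++ p
  at (++-comm p q) g = ≡.trans (lin-++ p q _) (≡.trans (ℤP.+-comm (coef p g) _) (≡.sym (lin-++ q p _)))

  ++-inverseʳ : ∀ p → p ++ negate p ≈ []
  at (++-inverseʳ p) g = ≡.trans (lin-++ p (negate p) _)
    (≡.trans (≡.cong (λ z → coef p g ℤ.+ z) (lin-negate p (ind g))) (ℤP.+-inverseʳ (coef p g)))

  ≡⇒≈ : ∀ {p q} → p ≡ q → p ≈ q
  ≡⇒≈ ≡.refl = ≈-refl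

  isCommutativeRing : IsCommutativeRing _≈_ _++_ _⊛_ negate [] one
  isCommutativeRing = record
    { isRing = record
      { +-isAbelianGroup = record
        { isGroup = record
          { isMonoid = record
            { isSemigroup = record
              { isMagma = record
                { isEquivalence = record
                  { refl  = ≈-refl
                  ; sym   = ≈-sym
                  ; trans = ≈-trans
                  }
                ; ∙-cong = ++-cong
                }
              ; assoc = λ p q r → ≡⇒≈ (ListP.++-assoc p q r)
              }
            ; identity = (λ p → ≡⇒≈ ≡.refl) , (λ p → ≡⇒≈ (ListP.++-identityʳ p))
            }
          ; inverse = (λ p → ≈-trans (++-comm (negate p) p) (++-inverseʳ p)) , ++-inverseʳ
          ; ⁻¹-cong = λ {p} {q} eq → mk λ g →
              ≡.trans (lin-negate p _) (≡.trans (≡.cong ℤ.-_ (at eq g)) (≡.sym (lin-negate q _)))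
          }
        ; comm = ++-comm
        }
      ; *-cong     = ⊛-cong
      ; *-assoc    = ⊛-assoc
      ; *-identity = ⊛-identityˡ , (λ p → ≈-trans (⊛-comm p one) (⊛-identityˡ p))
      ; distrib    = ⊛-distribˡ , (λ p q r → ≈-trans (⊛-comm (q ++ r) p)
                       (≈-trans (⊛-distribˡ p q r) (++-cong (⊛-comm p q) (⊛-comm p r))))
      }
    ; *-comm = ⊛-comm
    }

  record Lead (p : Sum) (g : Carrier) : Set where
    constructor lead
    field
      positive : + 0 ℤ.< coef p g
      above    : ∀ h → g < h → coef p h ≡ + 0
  open Lead public

  Pos : Sum → Set
  Pos p = ∃ (Lead p)

  Lead-resp : ∀ {p q g} → p ≈ q → Lead p g → Lead q g
  Lead-resp p≈q (lead pos up) = lead (≡.subst (+ 0 ℤ.<_) (at p≈q _) pos) λ h g<h → ≡.trans (≡.sym (at p≈q h)) (up h g<h)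

  Lead-unique : ∀ {p g h} → Lead p g → Lead p h → g ≡ h
  Lead-unique {g = g} {h} (lead pos up) (lead pos′ up′) with compare g h
  ... | inj₁ g<h        = ⊥-elim (ℤP.<-irrefl (≡.sym (up h g<h)) pos′)
  ... | inj₂ (inj₁ g≡h) = g≡h
  ... | inj₂ (inj₂ h<g) = ⊥-elim (ℤP.<-irrefl (≡.sym (up′ g h<g)) pos)

  Lead⇒≉0 : ∀ {p g} → Lead p g → ¬ p ≈ []
  Lead⇒≉0 (lead pos _) p≈0 = ℤP.<-irrefl (≡.sym (at p≈0 _)) pos

  supported : ∀ p h → coef p h ≡ + 0 ⊎ h ∈ map proj₁ p
  supported []            h = inj₁ ≡.refl
  supported ((k , c) ∷ p) h with k ≟ h | supported p h
  ... | yes ≡.refl | _        = inj₂ (here ≡.refl)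
  ... | no  k≢h    | inj₁ eq  = inj₁ (≡.cong₂ ℤ._+_ (ℤP.*-zeroʳ c) eq)
  ... | no  k≢h    | inj₂ h∈p = inj₂ (there h∈p)

  -- The search tests the values of `F`, not the listed coefficients, because entries with the same
  -- exponent may cancel.
  top : (F : Carrier → ℤ) (es : List Carrier) →
        (∀ e → e ∈ es → F e ≡ + 0) ⊎ (∃ λ g → F g ≢ + 0 × (∀ e → e ∈ es → g < e → F e ≡ + 0))
  top F [] = inj₁ λ _ ()
  top F (e ∷ es) with F e ℤP.≟ + 0 | top F es
  ... | yes Fe≡0 | inj₁ none = inj₁ λ { _ (here ≡.refl) → Fe≡0 ; e′ (there e′∈) → none e′ e′∈ }
  ... | yes Fe≡0 | inj₂ (g , Fg≢0 , up) = inj₂ (g , Fg≢0 , λ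
        { _ (here ≡.refl) _ → Fe≡0 ; e′ (there e′∈) → up e′ e′∈ })
  ... | no Fe≢0 | inj₁ none = inj₂ (e , Fe≢0 , λ
        { _ (here ≡.refl) e<e → ⊥-elim (proj₂ e<e ≡.refl) ; e′ (there e′∈) _ → none e′ e′∈ })
  ... | no Fe≢0 | inj₂ (g , Fg≢0 , up) with ≤⊎> e g
  ...   | inj₁ e≤g = inj₂ (g , Fg≢0 , λ
          { _ (here ≡.refl) g<e → ⊥-elim (<⇒≱ g<e e≤g) ; e′ (there e′∈) → up e′ e′∈ })
  ...   | inj₂ g<e = inj₂ (e , Fe≢0 , λ
          { _ (here ≡.refl) e<e → ⊥-elim (proj₂ e<e ≡.refl) ; e′ (there e′∈) e<e′ → up e′ e′∈ (<-≤-trans g<e (proj₁ e<e′)) })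

  trichotomy : ∀ p → Pos p ⊎ p ≈ [] ⊎ Pos (negate p)
  trichotomy p with top (coef p) (map proj₁ p)
  ... | inj₁ none = inj₂ (inj₁ (mk λ g → [ (λ eq → eq) , none g ]′ (supported p g)))
  ... | inj₂ (g , pg≢0 , up) with ℤP.<-cmp (coef p g) (+ 0)
  ...   | tri≈ _ eq _ = ⊥-elim (pg≢0 eq)
  ...   | tri> _ _ pg>0 = inj₁ (g , lead pg>0 λ h g<h → [ (λ eq → eq) , (λ h∈ → up h h∈ g<h) ]′ (supported p h))
  ...   | tri< pg<0 _ _ = inj₂ (inj₂ (g , lead
          (≡.subst (+ 0 ℤ.<_) (≡.sym (lin-negate p _)) (ℤP.neg-mono-< pg<0))
          λ h g<h → ≡.trans (lin-negate p _) (≡.cong ℤ.-_ ([ (λ eq → eq) , (λ h∈ → up h h∈ g<h) ]′ (supported p h)))))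

  Lead-+-≡ : ∀ {p q g} → Lead p g → Lead q g → Lead (p ++ q) g
  Lead-+-≡ {p} {q} (lead pos up) (lead pos′ up′) = lead
    (≡.subst (+ 0 ℤ.<_) (≡.sym (lin-++ p q _)) (ℤP.+-mono-< pos pos′))
    λ h g<h → ≡.trans (lin-++ p q _) (≡.cong₂ ℤ._+_ (up h g<h) (up′ h g<h))

  Lead-+-< : ∀ {p q g h} → h < g → Lead p h → Lead q g → Lead (p ++ q) g
  Lead-+-< {p} {q} {g} h<g (lead _ up) (lead pos′ up′) = lead
    (≡.subst (+ 0 ℤ.<_) (≡.sym (≡.trans (lin-++ p q _) (≡.trans (≡.cong (ℤ._+ coef q g) (up g h<g)) (ℤP.+-identityˡ _)))) pos′)
    λ k g<k → ≡.trans (lin-++ p q _) (≡.cong₂ ℤ._+_ (up k (<-≤-trans h<g (proj₁ g<k))) (up′ k g<k))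

  -- Entries above the leading exponent cancel but still stand in the list. Removing them permits
  -- termwise arguments about products.
  truncate : Carrier → Sum → Sum
  truncate g []            = []
  truncate g ((h , c) ∷ p) with ≤⊎> h g
  ... | inj₁ _ = (h , c) ∷ truncate g p
  ... | inj₂ _ = truncate g p

  coef-truncate-≤ : ∀ g p h → h ≤ g → coef (truncate g p) h ≡ coef p h
  coef-truncate-≤ g []            h h≤g = ≡.refl
  coef-truncate-≤ g ((k , c) ∷ p) h h≤g with ≤⊎> k g
  ... | inj₁ _   = ≡.cong (λ z → c ℤ.* ind h k ℤ.+ z) (coef-truncate-≤ g p h h≤g)
  ... | inj₂ g<k = ≡.trans (coef-truncate-≤ g p h h≤g)
        (≡.sym (≡.trans (≡.cong (ℤ._+ coef p h) (≡.trans (≡.cong (c ℤ.*_) (ind-off λ { ≡.refl → <⇒≱ g<k h≤g })) (ℤP.*-zeroʳ c)))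
                        (ℤP.+-identityˡ _)))

  coef-truncate-> : ∀ g p h → g < h → coef (truncate g p) h ≡ + 0
  coef-truncate-> g []            h g<h = ≡.refl
  coef-truncate-> g ((k , c) ∷ p) h g<h with ≤⊎> k g
  ... | inj₁ k≤g = ≡.cong₂ ℤ._+_ (≡.trans (≡.cong (c ℤ.*_) (ind-off λ { ≡.refl → <⇒≱ g<h k≤g })) (ℤP.*-zeroʳ c))
                                 (coef-truncate-> g p h g<h)
  ... | inj₂ _   = coef-truncate-> g p h g<h

  truncate-≈ : ∀ {p g} → Lead p g → p ≈ truncate g p
  at (truncate-≈ {p} {g} (lead _ up)) h with ≤⊎> h g
  ... | inj₁ h≤g = ≡.sym (coef-truncate-≤ g p h h≤g)
  ... | inj₂ g<h = ≡.trans (up h g<h) (≡.sym (coef-truncate-> g p h g<h))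

  lin-truncate-cong : ∀ g p {F F′} → (∀ h → h ≤ g → F h ≡ F′ h) → lin (truncate g p) F ≡ lin (truncate g p) F′
  lin-truncate-cong g []            eq = ≡.refl
  lin-truncate-cong g ((h , c) ∷ p) eq with ≤⊎> h g
  ... | inj₁ h≤g = ≡.cong₂ ℤ._+_ (≡.cong (c ℤ.*_) (eq h h≤g)) (lin-truncate-cong g p eq)
  ... | inj₂ _   = lin-truncate-cong g p eq

  -- After truncation all exponents of `p` are at most `g`. Above g + h each of them meets a zero
  -- coefficient of `q`, and at g + h only `g` itself contributes, giving the product of the leading
  -- coefficients.
  Lead-⊛ : ∀ {p q g h} → Lead p g → Lead q h → Lead (p ⊛ q) (g + h)
  Lead-⊛ {p} {q} {g} {h} p-lead q-lead = lead
    (≡.subst (+ 0 ℤ.<_) (≡.sym top-coef) (0<* (positive p-lead) (positive q-lead)))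
    λ k gh<k → begin
      coef (p ⊛ q) k                                    ≡⟨ coef-trunc k ⟩
      lin (truncate g p) (λ x → coef q (k - x))         ≡⟨ lin-truncate-cong g p (λ x x≤g → above q-lead (k - x) (<-≤⇒residual gh<k x≤g)) ⟩
      lin (truncate g p) (λ _ → + 0)                    ≡⟨ lin-0 (truncate g p) ⟩
      + 0                                               ∎
    where
    open ≡.≡-Reasoning
    0<* : ∀ {i j} → + 0 ℤ.< i → + 0 ℤ.< j → + 0 ℤ.< i ℤ.* j
    0<* (ℤ.+<+ (s≤s z≤n)) (ℤ.+<+ (s≤s z≤n)) = ℤ.+<+ (s≤s z≤n)

    coef-trunc : ∀ k → coef (p ⊛ q) k ≡ lin (truncate g p) (λ x → coef q (k - x))
    coef-trunc k = ≡.trans (at (⊛-cong (truncate-≈ p-lead) ≈-refl) k) (coef-⊛ (truncate g p) q k)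

    pick : ∀ x → x ≤ g → coef q ((g + h) - x) ≡ coef q h ℤ.* ind g x
    pick x x≤g with compare x g
    ... | inj₂ (inj₁ ≡.refl) = ≡.trans (≡.cong (coef q) (cancel′ x h))
          (≡.sym (≡.trans (≡.cong (coef q h ℤ.*_) (ind-diag x)) (ℤP.*-identityʳ _)))
    ... | inj₂ (inj₂ g<x) = ⊥-elim (<⇒≱ g<x x≤g)
    ... | inj₁ x<g = ≡.trans (above q-lead _ (≤-<⇒residual (IsTotalOrder.refl (RealField.isTotalOrder ℝ)) x<g))
          (≡.sym (≡.trans (≡.cong (coef q h ℤ.*_) (ind-off (proj₂ x<g))) (ℤP.*-zeroʳ (coef q h))))

    top-coef : coef (p ⊛ q) (g + h) ≡ coef p g ℤ.* coef q h
    top-coef = begin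
      coef (p ⊛ q) (g + h)                                ≡⟨ coef-trunc (g + h) ⟩
      lin (truncate g p) (λ x → coef q ((g + h) - x))     ≡⟨ lin-truncate-cong g p pick ⟩
      lin (truncate g p) (λ x → coef q h ℤ.* ind g x)     ≡⟨ lin-* (truncate g p) (coef q h) (ind g) ⟩
      coef q h ℤ.* coef (truncate g p) g                  ≡⟨ ≡.cong (coef q h ℤ.*_) (at (truncate-≈ p-lead) g) ⟨
      coef q h ℤ.* coef p g                               ≡⟨ ℤP.*-comm (coef q h) (coef p g) ⟩
      coef p g ℤ.* coef q h                               ∎

  t^ : Carrier → Sum
  t^ g = (g , + 1) ∷ []

  coef-t^ : ∀ g h → coef (t^ g) h ≡ ind h g
  coef-t^ g h = ≡.trans (ℤP.+-identityʳ _) (ℤP.*-identityˡ _)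

  Lead-t^ : ∀ g → Lead (t^ g) g
  Lead-t^ g = lead
    (≡.subst (+ 0 ℤ.<_) (≡.sym (≡.trans (coef-t^ g g) (ind-diag g))) (ℤ.+<+ (s≤s z≤n)))
    λ h g<h → ≡.trans (coef-t^ g h) (ind-off (proj₂ g<h))

  -- The factor 2 settles the case of equal exponents, where the leading terms could cancel.
  Lead-double-minus : ∀ {q g} h → Lead q g → h ≤ g → Lead ((q ++ q) ++ negate (t^ h)) g
  Lead-double-minus {q} {g} h (lead pos up) h≤g = lead
    (≡.subst (+ 0 ℤ.<_) (≡.sym (value g)) (sign (coef q g) pos (h ≟ g)))
    λ k g<k → ≡.trans (value k) (≡.cong₂ (λ x y → x ℤ.+ x ℤ.+ ℤ.- y) (up k g<k)
      (ind-off λ { ≡.refl → <⇒≱ g<k h≤g }))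
    where
    value : ∀ k → coef ((q ++ q) ++ negate (t^ h)) k ≡ coef q k ℤ.+ coef q k ℤ.+ ℤ.- ind k h
    value k = ≡.trans (lin-++ (q ++ q) (negate (t^ h)) (ind k)) (≡.cong₂ ℤ._+_ (lin-++ q q (ind k))
      (≡.trans (lin-negate (t^ h) (ind k)) (≡.cong ℤ.-_ (coef-t^ h k))))
    sign : ∀ i → + 0 ℤ.< i → Dec (h ≡ g) → + 0 ℤ.< i ℤ.+ i ℤ.+ ℤ.- ind g h
    sign i i>0 (no h≢g) = ≡.subst (λ z → + 0 ℤ.< i ℤ.+ i ℤ.+ ℤ.- z) (≡.sym (ind-off h≢g))
      (≡.subst (+ 0 ℤ.<_) (≡.sym (ℤP.+-identityʳ _)) (ℤP.+-mono-< i>0 i>0))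
    sign i (ℤ.+<+ (s≤s {n = n} z≤n)) (yes ≡.refl) = ≡.subst (λ z → + 0 ℤ.< i ℤ.+ i ℤ.+ ℤ.- z) (≡.sym (ind-diag h))
      (≡.subst (λ k → + 0 ℤ.< + k) (≡.sym (ℕP.+-suc n n)) (ℤ.+<+ (s≤s z≤n)))

  t^-* : ∀ g h → t^ g ⊛ t^ h ≈ t^ (g + h)
  t^-* g h = ≈-refl

  orderedDomain : OrderedDomain
  orderedDomain = record
    { commutativeRing = record { isCommutativeRing = isCommutativeRing }
    ; Pos        = Pos
    ; Pos-resp   = λ p≈q (g , p-lead) → g , Lead-resp p≈q p-lead
    ; trichotomy = trichotomy
    ; Pos⇒≉0     = λ (_ , p-lead) → Lead⇒≉0 p-lead
    ; Pos-+      = λ (g , p-lead) (h , q-lead) → sum-pos p-lead q-lead (compare g h)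
    ; Pos-*      = λ (g , p-lead) (h , q-lead) → g + h , Lead-⊛ p-lead q-lead
    ; Pos-1      = 0# , Lead-t^ 0#
    ; cofinal    = λ (g , a-lead) → cofinal a-lead
    }
    where
    -- The multiplier is 2t^(-g). The leading coefficient of `a` is an integer and at least 1, so
    -- the product has constant term at least 2, which stays positive after subtracting 1.
    cofinal : ∀ {a g} → Lead a g → ∃ λ m → Pos m × Pos (m ⊛ a ++ negate one)
    cofinal {a} {g} a-lead = m ++ m
      , (- g , Lead-+-≡ {m} {m} (Lead-t^ (- g)) (Lead-t^ (- g)))
      , 0# , Lead-resp (++-cong {m ⊛ a ++ m ⊛ a} {(m ++ m) ⊛ a} {negate one} {negate one} doubled ≈-refl)
               (Lead-double-minus {m ⊛ a} 0# ma-lead (IsTotalOrder.refl (RealField.isTotalOrder ℝ)))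
      where
      m : Sum
      m = t^ (- g)
      doubled : m ⊛ a ++ m ⊛ a ≈ (m ++ m) ⊛ a
      doubled = ≈-trans (≈-trans (++-cong (⊛-comm m a) (⊛-comm m a)) (≈-sym (⊛-distribˡ a m m))) (⊛-comm a (m ++ m))
      ma-lead : Lead (m ⊛ a) 0#
      ma-lead = ≡.subst (Lead (m ⊛ a)) (-‿inverseˡ g) (Lead-⊛ (Lead-t^ (- g)) a-lead)
    sum-pos : ∀ {p q g h} → Lead p g → Lead q h → g < h ⊎ g ≡ h ⊎ h < g → Pos (p ++ q)
    sum-pos p-lead q-lead (inj₁ g<h)            = _ , Lead-+-< g<h p-lead q-lead
    sum-pos p-lead q-lead (inj₂ (inj₁ ≡.refl))  = _ , Lead-+-≡ p-lead q-lead
    sum-pos {p} {q} p-lead q-lead (inj₂ (inj₂ h<g)) =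
      _ , Lead-resp (++-comm q p) (Lead-+-< h<g q-lead p-lead)

-- Tropical cones and their lifts

module MaxPlusOrder (ℝ : RealField) where
  open MaxPlus ℝ public
  open IsTotalOrder (RealField.isTotalOrder ℝ)
    using (total) renaming (refl to ≤-refl; trans to ≤-trans)

  ≤ₘ-refl : ∀ {a} → a ≤ₘ a
  ≤ₘ-refl { -∞}   = -∞≤
  ≤ₘ-refl {fin x} = fin≤ ≤-refl

  ≤ₘ-trans : ∀ {a b c} → a ≤ₘ b → b ≤ₘ c → a ≤ₘ c
  ≤ₘ-trans -∞≤        _          = -∞≤
  ≤ₘ-trans (fin≤ x≤y) (fin≤ y≤z) = fin≤ (≤-trans x≤y y≤z)

  ⊕-upperˡ : ∀ a b → a ≤ₘ (a ⊕ b)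
  ⊕-upperˡ -∞      b       = -∞≤
  ⊕-upperˡ (fin x) -∞      = ≤ₘ-refl
  ⊕-upperˡ (fin x) (fin y) with total x y
  ... | inj₁ x≤y = fin≤ x≤y
  ... | inj₂ _   = ≤ₘ-refl

  ⊕-upperʳ : ∀ a b → b ≤ₘ (a ⊕ b)
  ⊕-upperʳ -∞      b       = ≤ₘ-refl
  ⊕-upperʳ (fin x) -∞      = -∞≤
  ⊕-upperʳ (fin x) (fin y) with total x y
  ... | inj₁ _   = ≤ₘ-refl
  ... | inj₂ y≤x = fin≤ y≤x

  ⊕-least : ∀ {a b c} → a ≤ₘ c → b ≤ₘ c → (a ⊕ b) ≤ₘ c
  ⊕-least { -∞}           _   b≤c = b≤c
  ⊕-least {fin x} { -∞}   a≤c _   = a≤c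
  ⊕-least {fin x} {fin y} a≤c b≤c with total x y
  ... | inj₁ _ = b≤c
  ... | inj₂ _ = a≤c

  maxⱼ-upper : ∀ {d} (f : Fin d → ℝmax) j → f j ≤ₘ maxⱼ f
  maxⱼ-upper f zero    = ⊕-upperˡ _ _
  maxⱼ-upper f (suc j) = ≤ₘ-trans (maxⱼ-upper (f ∘ suc) j) (⊕-upperʳ (f zero) _)

  maxⱼ-least : ∀ {d} {f : Fin d → ℝmax} {c} → (∀ j → f j ≤ₘ c) → maxⱼ f ≤ₘ c
  maxⱼ-least {zero}  f≤c = -∞≤
  maxⱼ-least {suc d} f≤c = ⊕-least (f≤c zero) (maxⱼ-least (f≤c ∘ suc))

-- An ordered domain whose nonnegative elements are valued in ℝmax, with a section t of the valuation.
record ValuedDomain (ℝ : RealField) : Set₁ where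
  open MaxPlus ℝ
  field
    orderedDomain : OrderedDomain
  open OrderedDomainProperties orderedDomain
  field
    V         : Carrier → ℝmax → Set
    V-resp    : ∀ {x y a} → x ≈ y → V x a → V y a
    V-unique  : ∀ {x a b} → V x a → V x b → a ≡ b
    V-zero    : V 0# -∞
    V-Pos     : ∀ {x} → Pos x → ∃ λ g → V x (fin g)
    V-∞⇒≈0    : ∀ {x} → V x -∞ → x ≈ 0#
    V-fin⇒Pos : ∀ {x g} → V x (fin g) → Pos x
    V-+       : ∀ {x y a b} → V x a → V y b → V (x + y) (a ⊕ b)
    V-*       : ∀ {x y a b} → V x a → V y b → V (x * y) (a ⊗ b)
    t         : ℝmax → Carrier
    V-t       : ∀ a → V (t a) a
    t-*       : ∀ a b → t a * t b ≈ t (a ⊗ b)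
    dominated : ∀ {x a b} → V x b → a ≤ₘ b → NonNeg (x + x - t a)

-- The leading exponent as a valuation in ℝmax

module GroupRingValuation (ℝ : RealField) where
  open MaxPlus ℝ
  open GroupRing ℝ
  open List using ([]; _++_)
  open IsTotalOrder (RealField.isTotalOrder ℝ) using (total)

  data V : Sum → ℝmax → Set where
    zero  : ∀ {p} → p ≈ [] → V p -∞
    lead  : ∀ {p g} → Lead p g → V p (fin g)

  Lead-+-≤ : ∀ {p q g h} → Lead p g → Lead q h → g ≤ h → Lead (p ++ q) h
  Lead-+-≤ {g = g} {h} p-lead q-lead g≤h with compare g h
  ... | inj₁ g<h           = Lead-+-< g<h p-lead q-lead
  ... | inj₂ (inj₁ ≡.refl) = Lead-+-≡ p-lead q-lead
  ... | inj₂ (inj₂ h<g)    = ⊥-elim (<⇒≱ h<g g≤h)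

  V-resp : ∀ {p q a} → p ≈ q → V p a → V q a
  V-resp p≈q (zero p≈0)    = zero (≈-trans (≈-sym p≈q) p≈0)
  V-resp p≈q (lead p-lead) = lead (Lead-resp p≈q p-lead)

  V-unique : ∀ {p a b} → V p a → V p b → a ≡ b
  V-unique (zero _)      (zero _)       = ≡.refl
  V-unique (zero p≈0)    (lead p-lead)  = ⊥-elim (Lead⇒≉0 p-lead p≈0)
  V-unique (lead p-lead) (zero p≈0)     = ⊥-elim (Lead⇒≉0 p-lead p≈0)
  V-unique (lead p-lead) (lead p-lead′) = ≡.cong fin (Lead-unique p-lead p-lead′)

  -- The maximum is attained even for equal valuations: leading coefficients are positive and cannot
  -- cancel.
  V-+ : ∀ {p q a b} → V p a → V q b → V (p ++ q) (a ⊕ b)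
  V-+ {p} {q} (zero p≈0) q-val = V-resp {q} {p ++ q} (++-cong {q = q} (≈-sym p≈0) ≈-refl) q-val
  V-+ {p} {q} (lead p-lead) (zero q≈0) =
    V-resp (++-comm q p) (V-resp {p} {q ++ p} (++-cong {q = p} (≈-sym q≈0) ≈-refl) (lead p-lead))
  V-+ {p} {q} {fin g} {fin h} (lead p-lead) (lead q-lead) with total g h
  ... | inj₁ g≤h = lead (Lead-+-≤ p-lead q-lead g≤h)
  ... | inj₂ h≤g = lead (Lead-resp (++-comm q p) (Lead-+-≤ q-lead p-lead h≤g))

  V-* : ∀ {p q a b} → V p a → V q b → V (p ⊛ q) (a ⊗ b)
  V-* {p} {q} (zero p≈0) _ = zero (⊛-cong p≈0 ≈-refl)
  V-* {p} {q} (lead _) (zero q≈0) = zero (≈-trans (⊛-comm p q) (⊛-cong q≈0 ≈-refl))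
  V-* (lead p-lead) (lead q-lead) = lead (Lead-⊛ p-lead q-lead)

  t : ℝmax → Sum
  t -∞      = []
  t (fin g) = t^ g

  V-t : ∀ a → V (t a) a
  V-t -∞      = zero ≈-refl
  V-t (fin g) = lead (Lead-t^ g)

  t-* : ∀ a b → t a ⊛ t b ≈ t (a ⊗ b)
  t-* -∞      b       = mk λ _ → ≡.refl
  t-* (fin g) -∞      = mk λ _ → ≡.refl
  t-* (fin g) (fin h) = t^-* g h

  dominated : ∀ {q a b} → V q b → a ≤ₘ b → Pos ((q ++ q) ++ negate (t a)) ⊎ ((q ++ q) ++ negate (t a)) ≈ []
  dominated {q} (zero q≈0)    -∞≤        = inj₂ (++-cong (++-cong q≈0 q≈0) ≈-refl)
  dominated {q} (lead q-lead) -∞≤        = inj₁ (_ , Lead-resp (++-comm [] (q ++ q)) (Lead-+-≡ q-lead q-lead))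
  dominated {q} (lead q-lead) (fin≤ {x} x≤y) = inj₁ (_ , Lead-double-minus x q-lead x≤y)

  valuedDomain : ValuedDomain ℝ
  valuedDomain = record
    { orderedDomain = orderedDomain
    ; V = V
    ; V-resp = V-resp
    ; V-unique = V-unique
    ; V-zero = V-t -∞
    ; V-Pos = λ (g , p-lead) → g , lead p-lead
    ; V-∞⇒≈0 = λ { (zero p≈0) → p≈0 }
    ; V-fin⇒Pos = λ { (lead p-lead) → _ , p-lead }
    ; V-+ = V-+
    ; V-* = V-*
    ; t = t
    ; V-t = V-t
    ; t-* = t-*
    ; dominated = dominated
    }

HasMinima-⇒ : ∀ {m} {_≺_ _≺′_ : Fin m → Fin m → Set} → (∀ k j → k ≺ j → k ≺′ j) →
              HasMinima _≺_ → HasMinima _≺′_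
HasMinima-⇒ ≺⇒≺′ minima S S? nonempty with minima S S? nonempty
... | k , Sk , least = k , Sk , λ j Sj j≢k → ≺⇒≺′ k j (least j Sj j≢k)

module TropicalCone {ℝ : RealField} (𝕍 : ValuedDomain ℝ) {p D : ℕ}
  (A B : Fin p → Fin (suc D) → MaxPlus.ℝmax ℝ) where

  open MaxPlusOrder ℝ
  open ValuedDomain 𝕍
  open OrderedDomainProperties orderedDomain

  V⇒NonNeg : ∀ {x a} → V x a → NonNeg x
  V⇒NonNeg {a = -∞}    x-val = inj₂ (V-∞⇒≈0 x-val)
  V⇒NonNeg {a = fin g} x-val = inj₁ (V-fin⇒Pos x-val)

  value : ∀ {x} → NonNeg x → ∃ λ a → V x a
  value (inj₁ x>0) = fin (proj₁ (V-Pos x>0)) , proj₂ (V-Pos x>0)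
  value (inj₂ x≈0) = -∞ , V-resp (sym x≈0) V-zero

  V-sum : ∀ {n} {f : Fin n → Carrier} {a : Fin n → ℝmax} → (∀ j → V (f j) (a j)) → V (sum f) (maxⱼ a)
  V-sum {zero}  vals = V-resp (sym (sum-zero λ ())) V-zero
  V-sum {suc n} vals = V-resp (sym (sum-suc _)) (V-+ (vals zero) (V-sum (vals ∘ suc)))

  Vec : Set
  Vec = Fin (suc D) → Carrier

  dotᵗ : (Fin (suc D) → ℝmax) → Vec → Carrier
  dotᵗ a x = dot (λ j → t (a j)) x

  V-dotᵗ : ∀ a {x : Vec} {v : Vecₘ (suc D)} → (∀ j → V (x j) (v j)) → V (dotᵗ a x) (maxⱼ (λ j → a j ⊗ v j))
  V-dotᵗ a vals = V-sum λ j → V-* (V-t (a j)) (vals j)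

  -- The facets are p half-spaces and D + 1 coordinates. The form `suc p ℕ.+ D` displays the p + 1
  -- facets outside a frame, as the combinatorial bound requires.
  N≡ : suc p ℕ.+ D ≡ p ℕ.+ suc D
  N≡ = ≡.sym (ℕP.+-suc p D)

  Row : Set
  Row = Fin p ⊎ Fin (suc D)

  row : Fin (suc p ℕ.+ D) → Row
  row f = splitAt p (cast N≡ f)

  index : Row → Fin (suc p ℕ.+ D)
  index r = cast (≡.sym N≡) (join p (suc D) r)

  row-index : ∀ r → row (index r) ≡ r
  row-index r = ≡.trans (≡.cong (splitAt p) (FinP.cast-involutive N≡ (≡.sym N≡) (join p (suc D) r)))
    (FinP.splitAt-join p (suc D) r)

  -- The number 2(D + 1): one doubled copy of the right-hand side for each of the D + 1 terms on the
  -- left.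
  multiplier : Carrier
  multiplier = sum {suc D} (λ _ → 1# + 1#)

  -- The tropical half-space i becomes multiplier · Σⱼ t^(b i j) xⱼ ≥ Σⱼ t^(a i j) xⱼ; the
  -- multiplier, of valuation 0, makes the classical cone contain the lifts of all tropical points.
  coefficients : Row → Vec
  coefficients (inj₁ i) j = multiplier * t (B i j) + (- 1#) * t (A i j)
  coefficients (inj₂ j) = δ j

  M : Fin (suc p ℕ.+ D) → Vec
  M f = coefficients (row f)

  e : Vec
  e _ = 1#

  dot-e-Pos : ∀ x → (∀ j → NonNeg (x j)) → ∀ j → Pos (x j) → Pos (dot e x)
  dot-e-Pos x x≥0 j x>0 = Pos-resp
    (sym (trans (sum-remove j _) (+-congʳ (*-identityˡ _))))
    (Pos-NonNeg-+ x>0 (NonNeg-sum λ i → NonNeg-resp (sym (*-identityˡ _)) (x≥0 _)))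

  at-row : ∀ {P : Vec → Set} → (∀ f → P (M f)) → ∀ r → P (coefficients r)
  at-row {P} all r = ≡.subst (P ∘ coefficients) (row-index r) (all (index r))

  pointed : ∀ w → (∃ λ j → ¬ w j ≈ 0#) → dot e w ≈ 0# → ∃ λ f → Pos (- dot (M f) w)
  pointed w (j , wj≉0) ew≈0 with any? (λ i → pos? (- w i))
  ... | yes (i , wi<0) = index (inj₂ i) , Pos-resp
        (-‿cong (trans (sym (dot-δ i w)) (reflexive (≡.cong (λ r → dot (coefficients r) w) (≡.sym (row-index (inj₂ i)))))))
        wi<0
  ... | no none = ⊥-elim (Pos⇒≉0 (dot-e-Pos w w≥0 j ([ (λ wj>0 → wj>0) , (λ wj≈0 → ⊥-elim (wj≉0 wj≈0)) ]′ (w≥0 j))) ew≈0)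
    where
    w≥0 : ∀ i → NonNeg (w i)
    w≥0 i = NonNeg-resp (-‿involutive _) (¬Pos⇒NonNeg-neg λ wi<0 → none (i , wi<0))

  open PolyhedralCone.Cone orderedDomain M e pointed hiding (Vec)

  K-NonNeg : ∀ {x} → InK x → ∀ j → NonNeg (x j)
  K-NonNeg {x} x∈K j = NonNeg-resp (dot-δ j x) (at-row {λ a → NonNeg (dot a x)} x∈K (inj₂ j))

  multiplier-* : ∀ q → multiplier * q ≈ sum {suc D} (λ _ → q + q)
  multiplier-* q = trans (sum-* q _) (sum-cong λ _ → trans (distribʳ q 1# 1#) (+-cong (*-identityˡ q) (*-identityˡ q)))

  half-space : ∀ i x → dot (coefficients (inj₁ i)) x ≈ sum {suc D} (λ _ → dotᵗ (B i) x + dotᵗ (B i) x) - dotᵗ (A i) x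
  half-space i x = begin
    dot (coefficients (inj₁ i)) x
      ≈⟨ dot-lin₁ multiplier (λ j → t (B i j)) (- 1#) (λ j → t (A i j)) x ⟩
    multiplier * dotᵗ (B i) x + (- 1#) * dotᵗ (A i) x
      ≈⟨ +-cong (multiplier-* _) (trans (sym (-‿distribˡ-* 1# _)) (-‿cong (*-identityˡ _))) ⟩
    sum {suc D} (λ _ → dotᵗ (B i) x + dotᵗ (B i) x) - dotᵗ (A i) x ∎

  -- The multiplied right-hand side is the left-hand side plus a nonnegative difference, so its
  -- valuation is a maximum involving that of the left. Being a sum of copies of the right-hand
  -- side, it also has the valuation of one copy.
  valuation-in-cone : ∀ {x v} → InK x → (∀ j → V (x j) (v j)) → InCone A B v
  valuation-in-cone {x} {v} x∈K vals i = ≤ₘ-trans (⊕-upperʳ r (maxⱼ λ j → A i j ⊗ v j))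
    (≡.subst (_≤ₘ b) (V-unique total (V-resp split (V-+ r-val (V-dotᵗ (A i) vals))))
      (maxⱼ-least {suc D} λ _ → ⊕-least ≤ₘ-refl ≤ₘ-refl))
    where
    q b-sum : Carrier
    q     = dotᵗ (B i) x
    b-sum = sum {suc D} (λ _ → q + q)
    b : ℝmax
    b = maxⱼ (λ j → B i j ⊗ v j)
    total : V b-sum (maxⱼ {suc D} (λ _ → b ⊕ b))
    total = V-sum λ _ → V-+ (V-dotᵗ (B i) vals) (V-dotᵗ (B i) vals)
    difference≥0 : NonNeg (b-sum - dotᵗ (A i) x)
    difference≥0 = NonNeg-resp (half-space i x) (at-row {λ a → NonNeg (dot a x)} x∈K (inj₁ i))
    r : ℝmax
    r = proj₁ (value difference≥0)
    r-val : V (b-sum - dotᵗ (A i) x) r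
    r-val = proj₂ (value difference≥0)
    split : b-sum - dotᵗ (A i) x + dotᵗ (A i) x ≈ b-sum
    split = solve 2 (λ x y → x :- y :+ y := x) refl b-sum (dotᵗ (A i) x)

  lift : Vecₘ (suc D) → Vec
  lift u j = t (u j)

  -- By the tropical inequality each term on the left has valuation at most that of the right-hand
  -- side, hence is at most twice the latter; the multiplier provides exactly one such double per
  -- term.
  lift-in-K : ∀ {u} → InCone A B u → InK (lift u)
  lift-in-K {u} u∈C f with row f
  ... | inj₂ j = NonNeg-resp (sym (dot-δ j (lift u))) (V⇒NonNeg (V-t (u j)))
  ... | inj₁ i = NonNeg-resp (sym (trans (half-space i (lift u)) termwise))
        (NonNeg-sum λ j → NonNeg-resp (+-congˡ (-‿cong (sym (t-* (A i j) (u j)))))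
          (dominated (V-dotᵗ (B i) (λ j → V-t (u j)))
            (≤ₘ-trans (maxⱼ-upper (λ j → A i j ⊗ u j) j) (u∈C i))))
    where
    q : Carrier
    q = dotᵗ (B i) (lift u)
    termwise : sum {suc D} (λ _ → q + q) - dotᵗ (A i) (lift u) ≈ sum (λ j → q + q - t (A i j) * t (u j))
    termwise = sym (begin
      sum (λ j → q + q - t (A i j) * t (u j))
        ≈⟨ sum-cong (λ j → +-congˡ (trans (-‿cong (sym (*-identityˡ _))) (-‿distribˡ-* 1# _))) ⟩
      sum (λ j → q + q + - 1# * (t (A i j) * t (u j)))
        ≈⟨ sum-+ _ _ ⟩
      sum {suc D} (λ _ → q + q) + sum (λ j → - 1# * (t (A i j) * t (u j)))
        ≈⟨ +-congˡ (trans (sym (*-sum (- 1#) _)) (trans (sym (-‿distribˡ-* 1# _)) (-‿cong (*-identityˡ _)))) ⟩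
      sum {suc D} (λ _ → q + q) - dotᵗ (A i) (lift u) ∎)

  K-scale : ∀ {s x} → Pos s → InK x → InK (λ j → s * x j)
  K-scale {s} {x} s>0 x∈K f = NonNeg-resp (sym (dot-scale (M f) s x)) (NonNeg-* (inj₁ s>0) (x∈K f))

  -- The factor `m` absorbs the rescalings made whenever a point is pushed to a facet.
  Over : Vecₘ (suc D) → Vec → Set
  Over u x = ∃ λ m → Pos m × (∀ j → V (m * x j) (u j))

  module Reals = RealOrder ℝ
  module ℝS = IntegerSolver Reals.ring

  -- After scaling, the sum of two points of the cone has valuation `u`. Both valuations lie in the
  -- tropical cone and their maximum is `u`, so extremality makes one of them equal to `u`.
  over-split : ∀ {u} → Extreme A B u → ∀ x y z {a b c} → Pos a → Pos b → Pos c → InK y → InK z →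
               (∀ j → a * x j ≈ b * y j + c * z j) → Over u x → Over u y ⊎ Over u z
  over-split {u} (_ , _ , indecomposable) x y z {a} {b} {c} a>0 b>0 c>0 y∈K z∈K ax≈by+cz (m , m>0 , mx-val) =
    Sum.map (λ u≡v → n * b , Pos-* n>0 b>0 , λ j → ≡.subst (V _) (≡.sym (u≡v j)) (v-val j))
            (λ u≡w → n * c , Pos-* n>0 c>0 , λ j → ≡.subst (V _) (≡.sym (u≡w j)) (w-val j))
      (indecomposable v w (valuation-in-cone ny∈K v-val) (valuation-in-cone nz∈K w-val) u≡v⊕w)
    where
    μ α : Reals.Carrier
    μ = proj₁ (V-Pos m>0)
    α = proj₁ (V-Pos a>0)
    -- In place of m/a: a monomial for which n a has the valuation of m, so that n a x is valued in
    -- `u` like m x.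
    n : Carrier
    n = t (fin (μ Reals.- α))
    n-val : V n (fin (μ Reals.- α))
    n-val = V-t _
    n>0 : Pos n
    n>0 = V-fin⇒Pos n-val
    na-val : V (n * a) (fin μ)
    na-val = ≡.subst (V (n * a)) (≡.cong fin (ℝS.solve 2 (λ μ α → (μ ℝS.:- α) ℝS.:+ α ℝS.:= μ) ≡.refl μ α))
      (V-* n-val (proj₂ (V-Pos a>0)))
    nax-val : ∀ j → V (n * a * x j) (u j)
    nax-val j = ≡.subst (V _) (V-unique (V-* (proj₂ (V-Pos m>0)) x-val) (mx-val j)) (V-* na-val x-val)
      where
      x-val : V (x j) _
      x-val = proj₂ (value (NonNeg-cancelˡ m>0 (V⇒NonNeg (mx-val j))))
    ny∈K : InK (λ j → n * b * y j)
    ny∈K = K-scale (Pos-* n>0 b>0) y∈K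
    nz∈K : InK (λ j → n * c * z j)
    nz∈K = K-scale (Pos-* n>0 c>0) z∈K
    v w : Vecₘ (suc D)
    v j = proj₁ (value (K-NonNeg ny∈K j))
    w j = proj₁ (value (K-NonNeg nz∈K j))
    v-val : ∀ j → V (n * b * y j) (v j)
    v-val j = proj₂ (value (K-NonNeg ny∈K j))
    w-val : ∀ j → V (n * c * z j) (w j)
    w-val j = proj₂ (value (K-NonNeg nz∈K j))
    u≡v⊕w : ∀ j → u j ≡ (v j ⊕ w j)
    u≡v⊕w j = V-unique (nax-val j) (V-resp (begin
      n * b * y j + n * c * z j
        ≈⟨ solve 5 (λ n b c y z → n :* b :* y :+ n :* c :* z := n :* (b :* y :+ c :* z)) refl n b c (y j) (z j) ⟩
      n * (b * y j + c * z j)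
        ≈⟨ *-congˡ (ax≈by+cz j) ⟨
      n * (a * x j)
        ≈⟨ *-assoc n a (x j) ⟨
      n * a * x j ∎) (V-+ (v-val j) (w-val j)))

  abstract
    extreme-vertex : ∀ {u} → Extreme A B u → ∃ λ x → InK x × Over u x × Frame D x
    extreme-vertex {u} u-extreme = vertex (Over u) (over-split u-extreme) (lift u) (lift-in-K (proj₁ u-extreme))
      (1# , Pos-1 , λ j → V-resp (sym (*-identityˡ _)) (V-t (u j)))

  over-Pos : ∀ {u x} → Extreme A B u → InK x → Over u x → Pos (dot e x)
  over-Pos {u} {x} (_ , u≢-∞ , _) x∈K (m , m>0 , mx-val) with any? (λ j → pos? (x j))
  ... | yes (j , xj>0) = dot-e-Pos x (K-NonNeg x∈K) j xj>0
  ... | no none = ⊥-elim (u≢-∞ λ j → V-unique (mx-val j)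
        (V-resp (sym (trans (*-congˡ (x≈0 j)) (zeroʳ m))) V-zero))
    where
    x≈0 : ∀ j → x j ≈ 0#
    x≈0 j = [ (λ xj>0 → ⊥-elim (none (j , xj>0))) , (λ xj≈0 → xj≈0) ]′ (K-NonNeg x∈K j)

  -- Ensures that vertices over distinct rays are not proportional. Valuations of s′x = s x′ give σ′
  -- + a = σ + b, while u = μ + a and u′ = μ′ + b; eliminating a and b gives `shift`.
  proportional⇒OnRay : ∀ {u u′ x x′ s s′} → Over u x → Over u′ x′ → Pos s → Pos s′ →
                       (∀ j → s′ * x j ≈ s * x′ j) → OnRay u′ u
  proportional⇒OnRay {u} {u′} {x} {x′} {s} {s′} (m , m>0 , mx-val) (m′ , m′>0 , mx′-val) s>0 s′>0 s′x≈sx′ =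
    fin shift , λ j →
      let a , x-val  = value (NonNeg-cancelˡ m>0 (V⇒NonNeg (mx-val j)))
          b , x′-val = value (NonNeg-cancelˡ m′>0 (V⇒NonNeg (mx′-val j)))
      in ≡.trans (V-unique (mx-val j) (V-* (proj₂ (V-Pos m>0)) x-val))
           (≡.trans (transfer a b (V-unique (V-* (proj₂ (V-Pos s′>0)) x-val)
                                    (V-resp (sym (s′x≈sx′ j)) (V-* (proj₂ (V-Pos s>0)) x′-val))))
             (≡.cong (fin shift ⊗_) (V-unique (V-* (proj₂ (V-Pos m′>0)) x′-val) (mx′-val j))))
    where
    μ μ′ σ σ′ shift : Reals.Carrier
    μ  = proj₁ (V-Pos m>0)
    μ′ = proj₁ (V-Pos m′>0)
    σ  = proj₁ (V-Pos s>0)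
    σ′ = proj₁ (V-Pos s′>0)
    shift = μ Reals.- σ′ Reals.+ σ Reals.- μ′

    fin-injective : ∀ {x y} → fin x ≡ fin y → x ≡ y
    fin-injective ≡.refl = ≡.refl

    transfer : ∀ a b → fin σ′ ⊗ a ≡ fin σ ⊗ b → fin μ ⊗ a ≡ fin shift ⊗ (fin μ′ ⊗ b)
    transfer -∞      -∞      _  = ≡.refl
    transfer (fin x) (fin y) eq = ≡.cong fin (≡.trans
      (ℝS.solve 3 (λ μ σ′ x → μ ℝS.:+ x ℝS.:= μ ℝS.:- σ′ ℝS.:+ (σ′ ℝS.:+ x)) ≡.refl μ σ′ x)
      (≡.trans (≡.cong (μ Reals.- σ′ Reals.+_) (fin-injective eq))
        (ℝS.solve 5 (λ μ σ′ σ μ′ y → μ ℝS.:- σ′ ℝS.:+ (σ ℝS.:+ y) ℝS.:= μ ℝS.:- σ′ ℝS.:+ σ ℝS.:- μ′ ℝS.:+ (μ′ ℝS.:+ y))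
          ≡.refl μ σ′ σ μ′ y)))

  extreme-rays-bound : ∀ {n} (g : Fin n → Vecₘ (suc D)) → (∀ k → Extreme A B (g k)) →
    (∀ k l → OnRay (g k) (g l) → k ≡ l) → n ℕ.≤ U (p ℕ.+ suc D) D
  extreme-rays-bound {n} g extreme distinct = upper-bound p
    (ratio-minima P Q Q>0 gap≉0)
    (HasMinima-⇒ reversed (ratio-minima (λ k → - P k) Q Q>0 λ j k j≢k eq → gap≉0 k j (j≢k ∘ ≡.sym)
      (trans (solve 4 (λ a b c d → a :* b :- c :* d := (:- c) :* d :- (:- a) :* b) refl (P k) (Q j) (P j) (Q k)) eq)))
    (λ k → Frame.φ (F k)) (λ k → independent⇒injective (Frame.independent (F k)))
    (λ k i → Pos (Obj.λᵢ k i)) (λ k i → pos? _)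
    -- A facet loose at `v j` cannot belong to the frame there, all of whose facets are tight.
    (λ k j k≺j → let i , λ>0 , loose = Obj.positive-side k (v j) (v∈K j) k≺j
                 in i , λ>0 , λ i′ eq → loose (≡.subst (λ f → ℓ f (v j) ≈ 0#) eq (Frame.tight (F j) i′)))
    (λ k j j≺k → let i , λ≯0 , loose = Obj.negative-side k (v j) (v∈K j) (Pos-resp
                       (solve 4 (λ a b c d → c :* d :- a :* b := :- (a :* b :- c :* d)) refl (P j) (Q k) (P k) (Q j)) j≺k)
                 in i , λ≯0 , λ i′ eq → loose (≡.subst (λ f → ℓ f (v j) ≈ 0#) eq (Frame.tight (F j) i′)))
    where
    v : Fin n → Vec
    v k = proj₁ (extreme-vertex (extreme k))
    v∈K : ∀ k → InK (v k)
    v∈K k = proj₁ (proj₂ (extreme-vertex (extreme k)))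
    over : ∀ k → Over (g k) (v k)
    over k = proj₁ (proj₂ (proj₂ (extreme-vertex (extreme k))))
    F : ∀ k → Frame D (v k)
    F k = proj₂ (proj₂ (proj₂ (extreme-vertex (extreme k))))

    Q : Fin n → Carrier
    Q k = dot e (v k)
    Q>0 : ∀ k → Pos (Q k)
    Q>0 k = over-Pos (extreme k) (v∈K k) (over k)

    -- Vanishes only if the two vertices are proportional, and its image under `c` is the
    -- cross-multiplied difference of their objective values. A functional generic for all these
    -- vectors therefore separates the vertices.
    W : Fin n → Fin n → Vec
    W j k i = Q k * v j i + (- Q j) * v k i

    generic : ∃ λ c → ∀ jk → (∃ λ i → ¬ W (proj₁ (remQuot {n} n jk)) (proj₂ (remQuot {n} n jk)) i ≈ 0#) →
                      ¬ dot c (W (proj₁ (remQuot {n} n jk)) (proj₂ (remQuot {n} n jk))) ≈ 0#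
    generic = generic-functional (λ jk → W (proj₁ (remQuot {n} n jk)) (proj₂ (remQuot {n} n jk)))
    c : Vec
    c = proj₁ generic
    P : Fin n → Carrier
    P k = dot c (v k)

    c-generic : ∀ j k → (∃ λ i → ¬ W j k i ≈ 0#) → ¬ dot c (W j k) ≈ 0#
    c-generic j k = ≡.subst (λ (j , k) → (∃ λ i → ¬ W j k i ≈ 0#) → ¬ dot c (W j k) ≈ 0#)
      (FinP.remQuot-combine j k) (proj₂ generic (combine j k))

    W≉0 : ∀ j k → j ≢ k → ∃ λ i → ¬ W j k i ≈ 0#
    W≉0 j k j≢k with any? (λ i → ¬? (0≟ (W j k i)))
    ... | yes found = found
    ... | no  none  = ⊥-elim (j≢k (≡.sym (distinct k j (proportional⇒OnRay (over j) (over k) (Q>0 j) (Q>0 k) λ i → begin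
      Q k * v j i
        ≈⟨ solve 4 (λ a b c d → a :* b := (a :* b :+ (:- c) :* d) :+ c :* d) refl (Q k) (v j i) (Q j) (v k i) ⟩
      W j k i + Q j * v k i
        ≈⟨ +-congʳ (decidable-stable (0≟ _) λ W≉0 → none (i , W≉0)) ⟩
      0# + Q j * v k i
        ≈⟨ +-identityˡ _ ⟩
      Q j * v k i ∎))))

    gap≉0 : ∀ j k → j ≢ k → ¬ P j * Q k - P k * Q j ≈ 0#
    gap≉0 j k j≢k eq = c-generic j k (W≉0 j k j≢k) (begin
      dot c (W j k)
        ≈⟨ dot-lin₂ c (Q k) (v j) (- Q j) (v k) ⟩
      Q k * P j + (- Q j) * P k
        ≈⟨ solve 4 (λ a b c d → a :* b :+ (:- c) :* d := b :* a :- d :* c) refl (Q k) (P j) (Q j) (P k) ⟩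
      P j * Q k - P k * Q j
        ≈⟨ eq ⟩
      0# ∎)

    reversed : ∀ k j → Pos ((- P j) * Q k - (- P k) * Q j) → Pos (P k * Q j - P j * Q k)
    reversed k j = Pos-resp (solve 4 (λ a b c d → (:- a) :* b :- (:- c) :* d := c :* d :- a :* b) refl (P j) (Q k) (P k) (Q j))

    module Obj (k : Fin n) = Objective c (F k) (Q>0 k)

open import Data.Nat using (_≤_; _+_; _∸_)

theorem1 : (ℝ : RealField) → let open MaxPlus ℝ in
    (p d : ℕ) → 1 ≤ p → 1 ≤ d →
    (A B : Fin p → Fin d → ℝmax) →
    (n : ℕ) (g : Fin n → Vecₘ d) →
    (∀ k → Extreme A B (g k)) →
    (∀ k l → OnRay (g k) (g l) → k ≡ l) →
    n ≤ U (p + d) (d ∸ 1)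
theorem1 ℝ p (suc D) _ _ A B n g extreme distinct =
  TropicalCone.extreme-rays-bound (GroupRingValuation.valuedDomain ℝ) A B g extreme distinct
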